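{- Let $H$ be the graph on vertex set $\{0,1,2,3\}$ with red edge set $\{\{0,2\},\{0,3\},\{1,3\}\}$ and blue edge set $\{\{0,1\}\}$. Then all of the following hold. (1) $\lambda_H=4/27$. (2) The semi-inducibility problem for $H$ is Erdős–Simonovits $(K_3,(1/3,1/3,1/3))$-stable. (3) The semi-inducibility problem for $H$ is perfectly $K_3$-stable.
   Context: All graphs are finite and simple; the order of a graph is its number of vertices. For a graph $H$ with $\kappa$ vertices whose edges are coloured red or blue and an uncoloured graph $G$ of order $n\ge\kappa$, an embedding of $H$ into $G$ is an injection $V(H)\to V(G)$ that maps red edges of $H$ to edges of $G$ and blue edges of $H$ to non-edges of $G$ (pairs of distinct non-adjacent vertices). $\Lambda_H(G)$ is the number of embeddings, $\lambda_H(G):=\Lambda_H(G)/\big(n(n-1)\cdots(n-\kappa+1)\big)$, $\lambda_H(n)$ is the maximum of $\lambda_H(G)$ over all graphs $G$ of order $n$, and $\lambda_H:=\lim_{n\to\infty}\lambda_H(n)$ (the limit exists). For a graph $B$ on $\{0,\dots,m-1\}$ and pairwise disjoint finite sets $V_0,\dots,V_{m-1}$ (some possibly empty), the blowup $B(V_0,\dots,V_{m-1})$ is the graph on $\bigcup_i V_i$ in which $x\in V_i$ and $y\in V_j$ are adjacent if and only if $\{i,j\}\in E(B)$ (so each $V_i$ is independent). The edit distance $\delta_{\mathrm{edit}}(G,G')$ between two graphs of the same order is the minimum of $|f(E(G))\bigtriangleup E(G')|$ over all bijections $f:V(G)\to V(G')$. Let $\mathbf x=(x_0,\dots,x_{m-1})$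 be a vector of non-negative reals summing to $1$. The semi-inducibility problem for $H$ is Erdős–Simonovits $(B,\mathbf x)$-stable if for every $\varepsilon>0$ there are $\delta>0$ and $n_0$ such that every graph $G$ of order $n\ge n_0$ with $\lambda_H(G)\ge\lambda_H-\delta$ admits a partition $V(G)=V_0\cup\dots\cup V_{m-1}$ with $\big||V_i|-x_in\big|<\varepsilon n$ for all $i$ and $|E(G)\bigtriangleup E(B(V_0,\dots,V_{m-1}))|\le\varepsilon\binom n2$. The semi-inducibility problem for $H$ is perfectly $B$-stable if there is $C>0$ such that for every graph $G$ of order $n\ge C$ there is a blowup $G'$ of $B$ of order $n$ with $\delta_{\mathrm{edit}}(G,G')\le C\,(\lambda_H(n)-\lambda_H(G))\,n^2$. (Here $C\ge\kappa$ may be assumed.) -}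

module Defs where

open import Data.Bool.Base using (Bool; true; false; T; _∧_; _∨_; not)
open import Data.Bool.Properties using (∨-comm; T?) renaming (_≟_ to _≟ᵇ_)
open import Data.Fin.Base using (Fin; zero; suc)
open import Data.Fin.Patterns using (0F; 1F; 2F; 3F)
open import Data.Fin.Properties using (_≟_; _<?_; all?; any?)
open import Data.Fin.Subset using (Subset; inside; outside)
open import Data.Integer.Base using (+_)
open import Data.List.Base
  using (List; []; _∷_; [_]; map; filter; length; allFin; cartesianProduct; cartesianProductWith)
import Data.List.Extrema as Extrema
open import Data.List.Membership.Propositional using (_∈_)
open import Data.List.Membership.Propositional.Properties
  using (∈-cartesianProductWith⁺; ∈-map⁺; ∈-map⁻)
open import Data.List.Properties using (filter-≐)
import Data.List.Relation.Unary.All as All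
open import Data.List.Relation.Unary.Any using (here; there)
open import Data.Nat.Base as ℕ using (ℕ; zero; suc; _^_)
open import Data.Nat.Combinatorics using (_P_; _C_)
import Data.Nat.Properties as ℕₚ
open import Data.Product.Base using (∃-syntax; Σ-syntax; _×_; _,_; proj₁; proj₂)
open import Data.Product.Properties using (≡-dec)
open import Data.Rational.Unnormalised.Base
  using (ℚᵘ; 0ℚᵘ; 1ℚᵘ; _/_; _≤_; _<_; _≃_; _+_; _-_; _*_; ∣_∣; *≡*)
import Data.Rational.Unnormalised.Properties as ℚₚ
open import Data.Sum.Base using (inj₁; inj₂)
open import Data.Vec.Base using (Vec; []; _∷_; lookup; tabulate)
open import Data.Vec.Properties using (lookup∘tabulate)
import Data.Vec.Functional as Vector
open import Function.Base using (_∘_; const; id)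
open import Function.Definitions using (Injective; StrictlySurjective)
open import Relation.Binary.PropositionalEquality
  using (_≡_; _≢_; refl; sym; trans; cong; cong₂; subst)
open import Relation.Nullary.Decidable
  using (Dec; yes; no; does; map′; _×-dec_; _→-dec_; ¬?; dec-true; from-yes)
open import Relation.Nullary.Negation using (¬_; contradiction)

private
  variable
    A : Set
    κ m n : ℕ

-- Taking Fin n as the vertex set loses nothing, since all notions below
-- are invariant under isomorphism.

record Graph (n : ℕ) : Set where
  field
    adj    : Fin n → Fin n → Bool
    symm   : ∀ u v → adj u v ≡ adj v u
    irrefl : ∀ u → adj u u ≡ false

open Graph public

Edge : Graph n → Fin n → Fin n → Set
Edge G u v = T (adj G u v)

NonEdge : Graph n → Fin n → Fin n → Set
NonEdge G u v = u ≢ v × ¬ Edge G u v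

_==_ : Fin n → Fin n → Bool
u == v = does (u ≟ v)

==-sym : (u v : Fin n) → (u == v) ≡ (v == u)
==-sym u v with u ≟ v | v ≟ u
... | yes _   | yes _   = refl
... | no  _   | no  _   = refl
... | yes u≡v | no  v≢u = contradiction (sym u≡v) v≢u
... | no  u≢v | yes v≡u = contradiction (sym v≡u) u≢v

complete : ∀ m → Graph m
complete m = record
  { adj    = λ u v → not (u == v)
  ; symm   = λ u v → cong not (==-sym u v)
  ; irrefl = λ u → cong not (dec-true (u ≟ u) refl)
  }

-- Each unordered edge {u, v} is listed once, in either order.

fromEdges : List (Fin n × Fin n) → Graph n
fromEdges {n} es = record
  { adj    = λ u v → not (u == v) ∧ (listed u v ∨ listed v u)
  ; symm   = λ u v → cong₂ _∧_ (cong not (==-sym u v)) (∨-comm (listed u v) (listed v u))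
  ; irrefl = λ u → cong (λ b → not b ∧ (listed u u ∨ listed u u)) (dec-true (u ≟ u) refl)
  }
  where
  open import Data.List.Membership.DecPropositional (≡-dec (_≟_ {n}) (_≟_ {n})) using (_∈?_)

  listed : Fin n → Fin n → Bool
  listed u v = does ((u , v) ∈? es)

record ColouredGraph (κ : ℕ) : Set where
  field
    red blue : Graph κ
    disjoint : ∀ i j → ¬ (Edge red i j × Edge blue i j)

open ColouredGraph public

record IsEmbedding (H : ColouredGraph κ) (G : Graph n) (f : Fin κ → Fin n) : Set where
  field
    injective : Injective _≡_ _≡_ f
    red⇒edge  : ∀ {i j} → Edge (red H) i j → Edge G (f i) (f j)
    blue⇒non  : ∀ {i j} → Edge (blue H) i j → NonEdge G (f i) (f j)

isInjective? : (f : Fin m → Fin n) → Dec (Injective _≡_ _≡_ f)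
isInjective? f = map′ (λ p {i} {j} → p i j) (λ p i j → p {i} {j})
  (all? λ i → all? λ j → (f i ≟ f j) →-dec (i ≟ j))

isEmbedding? : (H : ColouredGraph κ) (G : Graph n) (f : Fin κ → Fin n) → Dec (IsEmbedding H G f)
isEmbedding? H G f = map′
  (λ (p , q , r) → record
    { injective = λ {i} {j} → p {i} {j} ; red⇒edge = λ {i} {j} → q i j ; blue⇒non = λ {i} {j} → r i j })
  (λ e → let open IsEmbedding e in
    (λ {i} {j} → injective {i} {j}) , (λ i j → red⇒edge {i} {j}) , (λ i j → blue⇒non {i} {j}))
  (isInjective? f
    ×-dec all? (λ i → all? λ j → T? (adj (red H) i j) →-dec T? (adj G (f i) (f j)))
    ×-dec all? (λ i → all? λ j →
      T? (adj (blue H) i j) →-dec (¬? (f i ≟ f j) ×-dec ¬? (T? (adj G (f i) (f j))))))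

allVecs : List A → ∀ k → List (Vec A k)
allVecs xs zero    = [ [] ]
allVecs xs (suc k) = cartesianProductWith _∷_ xs (allVecs xs k)

-- Maps Fin κ → Fin n are enumerated as vectors, so that each occurs exactly once.

Λ : ColouredGraph κ → Graph n → ℕ
Λ {κ} {n} H G = length (filter (λ v → isEmbedding? H G (lookup v)) (allVecs (allFin n) κ))

-- The value at denominator 0 is irrelevant: n P κ, the falling factorial
-- n (n - 1) ⋯ (n - κ + 1), vanishes only for n < κ.

ratio : ℕ → ℕ → ℚᵘ
ratio a zero      = 0ℚᵘ
ratio a d@(suc _) = + a / d

density : ColouredGraph κ → Graph n → ℚᵘ
density {κ} {n} H G = ratio (Λ H G) (n P κ)

-- Add a vertex, as vertex 0, with the given neighbourhood.

extend : Graph n → Subset n → Graph (suc n)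
extend {n} G s = record { adj = adj′ ; symm = symm′ ; irrefl = irrefl′ }
  where
  adj′ : Fin (suc n) → Fin (suc n) → Bool
  adj′ zero    zero    = false
  adj′ zero    (suc v) = lookup s v
  adj′ (suc u) zero    = lookup s u
  adj′ (suc u) (suc v) = adj G u v

  symm′ : ∀ u v → adj′ u v ≡ adj′ v u
  symm′ zero    zero    = refl
  symm′ zero    (suc v) = refl
  symm′ (suc u) zero    = refl
  symm′ (suc u) (suc v) = symm G u v

  irrefl′ : ∀ u → adj′ u u ≡ false
  irrefl′ zero    = refl
  irrefl′ (suc u) = irrefl G u

graphs : ∀ n → List (Graph n)
graphs zero    = [ fromEdges [] ]
graphs (suc n) = cartesianProductWith extend (graphs n) (allVecs (outside ∷ inside ∷ []) n)

-- Densities are non-negative, so 0 is a harmless initial value.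

maxDensity : ColouredGraph κ → ℕ → ℚᵘ
maxDensity H n = Extrema.max ℚₚ.≤-totalOrder 0ℚᵘ (map (density H) (graphs n))

_≐_ : Graph n → Graph n → Set
G ≐ G′ = ∀ u v → adj G u v ≡ adj G′ u v

∈-allVecs : {xs : List A} → (∀ a → a ∈ xs) → ∀ {k} (v : Vec A k) → v ∈ allVecs xs k
∈-allVecs all []      = here refl
∈-allVecs all (a ∷ v) = ∈-cartesianProductWith⁺ _∷_ (all a) (∈-allVecs all v)

graphs-complete : (G : Graph n) → ∃[ G′ ] G′ ∈ graphs n × G ≐ G′
graphs-complete {zero}  G = _ , here refl , λ ()
graphs-complete {suc n} G =
  extend G′ s , ∈-cartesianProductWith⁺ extend G′∈ (∈-allVecs ∈-bools s) , same
  where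
  s : Subset n
  s = tabulate λ v → adj G zero (suc v)

  rest : Graph n
  rest = record
    { adj    = λ u v → adj G (suc u) (suc v)
    ; symm   = λ u v → symm G (suc u) (suc v)
    ; irrefl = λ u → irrefl G (suc u)
    }

  ih = graphs-complete rest
  G′ = proj₁ ih
  G′∈ = proj₁ (proj₂ ih)

  ∈-bools : ∀ b → b ∈ (outside ∷ inside ∷ [])
  ∈-bools false = here refl
  ∈-bools true  = there (here refl)

  same : G ≐ extend G′ s
  same zero    zero    = irrefl G zero
  same zero    (suc v) = sym (lookup∘tabulate _ v)
  same (suc u) zero    = trans (symm G (suc u) zero) (sym (lookup∘tabulate _ u))
  same (suc u) (suc v) = proj₂ (proj₂ ih) u v

embedding-≐ : (H : ColouredGraph κ) {G G′ : Graph n} → G ≐ G′ →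
              ∀ {f} → IsEmbedding H G f → IsEmbedding H G′ f
embedding-≐ H G≐G′ {f} e = record
  { injective = injective
  ; red⇒edge  = λ {i} {j} r → subst T (G≐G′ (f i) (f j)) (red⇒edge r)
  ; blue⇒non  = λ {i} {j} b → proj₁ (blue⇒non b) ,
      λ t → proj₂ (blue⇒non b) (subst T (sym (G≐G′ (f i) (f j))) t)
  }
  where open IsEmbedding e

density-≐ : (H : ColouredGraph κ) {G G′ : Graph n} → G ≐ G′ → density H G ≡ density H G′
density-≐ {κ} {n} H {G} {G′} G≐G′ = cong (λ a → ratio (length a) (n P κ))
  (filter-≐ (λ v → isEmbedding? H G (lookup v)) (λ v → isEmbedding? H G′ (lookup v))
    (embedding-≐ H G≐G′ , embedding-≐ H (λ u v → sym (G≐G′ u v)))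
    (allVecs (allFin n) κ))

ratio-nonNeg : ∀ a d → 0ℚᵘ ≤ ratio a d
ratio-nonNeg a       zero    = ℚₚ.≤-refl
ratio-nonNeg zero    (suc d) = ℚₚ.nonNegative⁻¹ (+ 0 / suc d)
ratio-nonNeg (suc a) (suc d) = ℚₚ.nonNegative⁻¹ (+ suc a / suc d)

density≤maxDensity : (H : ColouredGraph κ) (G : Graph n) → density H G ≤ maxDensity H n
density≤maxDensity {n = n} H G with G′ , G′∈ , G≐G′ ← graphs-complete G =
  subst (_≤ maxDensity H n) (sym (density-≐ H G≐G′))
    (All.lookup (Extrema.xs≤max ℚₚ.≤-totalOrder 0ℚᵘ _) (∈-map⁺ (density H) G′∈))

maxDensity-attained : (H : ColouredGraph κ) → ∀ n → Σ[ G ∈ Graph n ] density H G ≃ maxDensity H n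
maxDensity-attained {κ} H n
  with Extrema.argmax-sel ℚₚ.≤-totalOrder id 0ℚᵘ (map (density H) (graphs n))
... | inj₁ max≡0 = G₀ , ℚₚ.≤-antisym (density≤maxDensity H G₀)
        (subst (_≤ density H G₀) (sym max≡0) (ratio-nonNeg (Λ H G₀) (n P κ)))
  where G₀ = fromEdges []
... | inj₂ max∈ with G , _ , max≡ ← ∈-map⁻ (density H) max∈ = G , ℚₚ.≃-reflexive (sym max≡)

-- SemiInducibility H ℓ says that lim maxDensity H n = ℓ. As the library has
-- no real numbers, only rational limits are covered.

SemiInducibility : ColouredGraph κ → ℚᵘ → Set
SemiInducibility H ℓ =
  ∀ ε → 0ℚᵘ < ε → ∃[ N ] ∀ n → N ℕ.≤ n → ∣ maxDensity H n - ℓ ∣ < ε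

-- A partition into m possibly empty parts is a map p to Fin m, the parts
-- being its fibres.

blowup : Graph m → (Fin n → Fin m) → Graph n
blowup B p = record
  { adj    = λ u v → adj B (p u) (p v)
  ; symm   = λ u v → symm B (p u) (p v)
  ; irrefl = λ u → irrefl B (p u)
  }

partSize : (Fin n → Fin m) → Fin m → ℕ
partSize {n} p i = length (filter (λ u → p u ≟ i) (allFin n))

-- ∣ f(E(G)) △ E(G′) ∣ for a bijection f, counted by pulling pairs back
-- along f: pairs {u, v} whose status in G differs from that of
-- {f u, f v} in G′.

symDiffAlong : (Fin n → Fin n) → Graph n → Graph n → ℕ
symDiffAlong {n} f G G′ = length (filter
  (λ (u , v) → (u <? v) ×-dec ¬? (adj G u v ≟ᵇ adj G′ (f u) (f v)))
  (cartesianProduct (allFin n) (allFin n)))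

symDiff : Graph n → Graph n → ℕ
symDiff = symDiffAlong id

IsBijection : (Fin n → Fin n) → Set
IsBijection f = Injective _≡_ _≡_ f × StrictlySurjective _≡_ f

isBijection? : (f : Fin n → Fin n) → Dec (IsBijection f)
isBijection? f = isInjective? f ×-dec all? (λ y → any? λ x → f x ≟ y)

bijections : ∀ n → List (Vec (Fin n) n)
bijections n = filter (λ v → isBijection? (lookup v)) (allVecs (allFin n) n)

-- The initial value of the minimum is the one given by the identity bijection.

editDistance : Graph n → Graph n → ℕ
editDistance {n} G G′ = Extrema.min ℕₚ.≤-totalOrder (symDiff G G′)
  (map (λ v → symDiffAlong (lookup v) G G′) (bijections n))

fromℕ : ℕ → ℚᵘ
fromℕ k = + k / 1

record Weights (m : ℕ) : Set where
  field
    weight  : Fin m → ℚᵘ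
    nonNeg  : ∀ i → 0ℚᵘ ≤ weight i
    sum≃1   : Vector.foldr _+_ 0ℚᵘ weight ≃ 1ℚᵘ

open Weights public

thirds : Weights 3
thirds = record
  { weight = const (+ 1 / 3)
  ; nonNeg = λ _ → ℚₚ.nonNegative⁻¹ (+ 1 / 3)
  ; sum≃1  = *≡* refl
  }

-- Here ℓ, being a limit, is unique up to ≃. Restricting ε and δ to rationals
-- is immaterial, and so is κ ≤ n₀ (n₀ may be enlarged), which keeps to orders
-- where the density is meaningful.

ErdősSimonovitsStable : ColouredGraph κ → Graph m → Weights m → Set
ErdősSimonovitsStable {κ} {m} H B x = ∃[ ℓ ] SemiInducibility H ℓ ×
  (∀ ε → 0ℚᵘ < ε →
    ∃[ δ ] ∃[ n₀ ] 0ℚᵘ < δ × κ ℕ.≤ n₀ ×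
      (∀ n (G : Graph n) → n₀ ℕ.≤ n → ℓ - δ ≤ density H G →
        Σ[ p ∈ (Fin n → Fin m) ]
          (∀ i → ∣ fromℕ (partSize p i) - weight x i * fromℕ n ∣ < ε * fromℕ n) ×
          fromℕ (symDiff G (blowup B p)) ≤ ε * fromℕ (n C 2)))

-- A real constant can be enlarged to a rational one, as density H G never
-- exceeds maxDensity H n; the same justifies fromℕ κ ≤ c.

PerfectlyStable : ColouredGraph κ → Graph m → Set
PerfectlyStable {κ} {m} H B = ∃[ c ] 0ℚᵘ < c × fromℕ κ ≤ c ×
  (∀ n (G : Graph n) → c ≤ fromℕ n →
    Σ[ p ∈ (Fin n → Fin m) ]
      fromℕ (editDistance G (blowup B p)) ≤ c * (maxDensity H n - density H G) * fromℕ (n ^ 2))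

H : ColouredGraph 4
H = record
  { red      = redH
  ; blue     = blueH
  ; disjoint = redH∩blueH=∅
  }
  where
  redH blueH : Graph 4
  redH  = fromEdges ((0F , 2F) ∷ (0F , 3F) ∷ (1F , 3F) ∷ [])
  blueH = fromEdges ((0F , 1F) ∷ [])

  redH∩blueH=∅ : ∀ i j → ¬ (Edge redH i j × Edge blueH i j)
  redH∩blueH=∅ = from-yes (all? λ i → all? λ j →
    ¬? (T? (adj redH i j) ×-dec T? (adj blueH i j)))

K₃ : Graph 3
K₃ = complete 3

{-# OPTIONS --safe #-}
-- An embedding of H consists of a vertex x (the image of 0), a neighbour z of x,
-- and an edge vy from another neighbour v of x to a non-neighbour y of x. There
-- are at most d (n − 1 − d) such edges if x has degree d, so that
-- Λ ≤ Σ (d − 1) d (n − 1 − d) ≤ 4n⁴ / 27. What is lost consists of the deviation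
-- of the degrees from 2n / 3 and of the bad triples: the edges xv together with a
-- common non-neighbour y of x and v.
--
-- If little is lost, choose greedily three pairwise adjacent pivots that lie in
-- few bad triples, and put every vertex into the class of the first pivot to which
-- it is not adjacent. Up to vertices of exceptional degree, a pair whose status
-- differs from the one in the blowup given by these classes completes a bad triple
-- with a pivot. The blowup is nearly balanced, hence its degrees nearly maximise
-- (d − 1) d (n − 1 − d). Expanding around them, G loses a constant times n²
-- embeddings against this blowup for every wrong pair, since the bad triples and
-- the quadratic terms outweigh the linear terms. No comparison with the exact
-- value of the maximum is needed. A graph that loses a constant times n⁴ is
-- compared with the Turán graph.

module Submission where

open import Defs
import Algebra.Properties.Semiring.Sum as SemiringSum
open import Data.Bool.Base using (Bool; true; false; T; _∧_; not; _xor_)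
open import Data.Bool.Properties using (T?; T-∧; ∧-zeroʳ; not-involutive) renaming (_≟_ to _≟ᵇ_)
open import Data.Empty using (⊥-elim)
open import Data.Fin.Base using (Fin; zero; suc)
open import Data.Fin.Patterns using (0F; 1F; 2F; 3F)
open import Data.Fin.Properties using (_≟_; _<?_; all?; any?)
open import Data.Integer.Base using (+_)
import Data.Integer.Base as ℤ
import Data.Integer.Properties as ℤₚ
open import Data.List.Base
  using (List; []; _∷_; filter; length; map; tabulate; allFin; cartesianProductWith)
import Data.List.Extrema as Extrema
open import Data.List.Properties using (filter-++; length-++)
open import Data.Nat.Base
  using (ℕ; zero; suc; _+_; _*_; _∸_; _^_; ∣_-_∣; _≤_; _<_; _≤ᵇ_; z≤n; s≤s; NonZero; >-nonZero)
open import Data.Nat.Combinatorics using (_P_; _C_; nC1≡n; nCk+nC[k+1]≡[n+1]C[k+1])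
open import Data.Nat.Properties hiding (_≟_; _<?_)
open import Data.Nat.Tactic.RingSolver using (solve; solve-∀)
open import Data.Product.Base using (∃-syntax; Σ-syntax; _×_; _,_; proj₁; proj₂)
open import Data.Rational.Unnormalised.Base using (ℚᵘ; mkℚᵘ; _/_; 0ℚᵘ)
import Data.Rational.Unnormalised.Base as ℚ
import Data.Rational.Unnormalised.Properties as ℚₚ
open import Data.Sum.Base using (_⊎_; inj₁; inj₂)
open import Data.Unit.Base using (tt)
open import Data.Vec.Base as Vec using (Vec; lookup)
open import Function.Base using (_∘_; id; _$_; it)
open import Function.Bundles using (Equivalence)
open import Relation.Binary.PropositionalEquality
  using (_≡_; _≢_; refl; sym; trans; cong; cong₂; subst; subst₂)
open import Relation.Nullary.Decidable using (Dec; yes; no; does; ¬?; _×-dec_; from-yes)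
open import Relation.Nullary.Negation using (¬_; contradiction)

open SemiringSum +-*-semiring using (sum; sum-cong-≗; ∑-distrib-+; ∑-comm; *-distribˡ-sum)

private
  variable
    n : ℕ
    A B : Set

-- A linear combination of inequalities is applied by certifying that the
-- two sides agree up to a non-negative rest p.

linear : ∀ {l r L R} p → l ≤ r → R + l ≡ L + r + p → L ≤ R
linear {l} {r} {L} {R} p l≤r eq = +-cancelʳ-≤ r L R (begin
  L + r      ≤⟨ m≤m+n _ p ⟩
  L + r + p  ≡⟨ eq ⟨
  R + l      ≤⟨ +-monoʳ-≤ R l≤r ⟩
  R + r      ∎)
  where open ≤-Reasoning

-- Stated with sums, so that matching on `refl` eliminates the larger number and leaves identities
-- for the ring solver.
∣-∣-split : ∀ a b → (a + ∣ a - b ∣ ≡ b) ⊎ (b + ∣ a - b ∣ ≡ a)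
∣-∣-split a b with ≤-total a b
... | inj₁ a≤b = inj₁ (trans (cong (_+_ a) (m≤n⇒∣m-n∣≡n∸m a≤b)) (m+[n∸m]≡n a≤b))
... | inj₂ b≤a = inj₂ (trans (cong (_+_ b) (m≤n⇒∣n-m∣≡n∸m b≤a)) (m+[n∸m]≡n b≤a))

∣-∣-lub : ∀ a b {c} → a ≤ b + c → b ≤ a + c → ∣ a - b ∣ ≤ c
∣-∣-lub a b {c} a≤ b≤ with ∣-∣-split a b
... | inj₁ eq = +-cancelˡ-≤ a _ _ (subst (_≤ a + c) (sym eq) b≤)
... | inj₂ eq = +-cancelˡ-≤ b _ _ (subst (_≤ b + c) (sym eq) a≤)

∣-∣-ub : ∀ a b → a ≤ b + ∣ a - b ∣ × b ≤ a + ∣ a - b ∣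
∣-∣-ub a b with ∣-∣-split a b
... | inj₁ eq = ≤-trans (m≤m+n a _) (≤-trans (≤-reflexive eq) (m≤m+n b _)) , ≤-reflexive (sym eq)
... | inj₂ eq = ≤-reflexive (sym eq) , ≤-trans (m≤m+n b _) (≤-trans (≤-reflexive eq) (m≤m+n a _))

-- Finite sums

infixr 5 ∑

opaque

  ∑ : (Fin n → ℕ) → ℕ
  ∑ = sum

  ∑-zero : (f : Fin 0 → ℕ) → ∑ f ≡ 0
  ∑-zero f = refl

  ∑-suc : (f : Fin (suc n) → ℕ) → ∑ f ≡ f zero + ∑ (f ∘ suc)
  ∑-suc f = refl

  ∑-cong : {f g : Fin n → ℕ} → (∀ i → f i ≡ g i) → ∑ f ≡ ∑ g
  ∑-cong = sum-cong-≗

  ∑-mono : {f g : Fin n → ℕ} → (∀ i → f i ≤ g i) → ∑ f ≤ ∑ g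
  ∑-mono {zero}  f≤g = z≤n
  ∑-mono {suc n} f≤g = +-mono-≤ (f≤g zero) (∑-mono (λ i → f≤g (suc i)))

  ∑-+ : (f g : Fin n → ℕ) → ∑ (λ i → f i + g i) ≡ ∑ f + ∑ g
  ∑-+ = ∑-distrib-+

  ∑-*ˡ : ∀ k (f : Fin n → ℕ) → ∑ (λ i → k * f i) ≡ k * ∑ f
  ∑-*ˡ k f = sym (*-distribˡ-sum k f)

  ∑-const : ∀ n k → ∑ {n} (λ _ → k) ≡ n * k
  ∑-const zero    k = refl
  ∑-const (suc n) k = cong (_+_ k) (∑-const n k)

  ∑-swap : {m : ℕ} (f : Fin m → Fin n → ℕ) → ∑ (λ i → ∑ (f i)) ≡ ∑ (λ j → ∑ (λ i → f i j))
  ∑-swap = ∑-comm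

  ≤∑ : (f : Fin n → ℕ) → ∀ i → f i ≤ ∑ f
  ≤∑ f zero    = m≤m+n _ _
  ≤∑ f (suc i) = ≤-trans (≤∑ (f ∘ suc) i) (m≤n+m _ (f zero))

syntax ∑ (λ i → e) = ∑[ i ] e

∣∑-∑∣≤ : (f g : Fin n → ℕ) → ∣ ∑ f - ∑ g ∣ ≤ ∑[ i ] ∣ f i - g i ∣
∣∑-∑∣≤ f g = ∣-∣-lub (∑ f) (∑ g)
  (subst (∑ f ≤_) (∑-+ g _) (∑-mono λ i → proj₁ (∣-∣-ub (f i) (g i))))
  (subst (∑ g ≤_) (∑-+ f _) (∑-mono λ i → proj₂ (∣-∣-ub (f i) (g i))))

-- Indicators, counting and averaging

⟦_⟧ : Bool → ℕ
⟦ true  ⟧ = 1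
⟦ false ⟧ = 0

⟦∧⟧ : ∀ b c → ⟦ b ∧ c ⟧ ≡ ⟦ b ⟧ * ⟦ c ⟧
⟦∧⟧ false c = refl
⟦∧⟧ true  c = sym (+-identityʳ ⟦ c ⟧)

⟦⟧-mono : ∀ {b c} → (T b → T c) → ⟦ b ⟧ ≤ ⟦ c ⟧
⟦⟧-mono {false}         _ = z≤n
⟦⟧-mono {true}  {true}  _ = s≤s z≤n
⟦⟧-mono {true}  {false} f = ⊥-elim (f tt)

⟦not⟧ : ∀ b → ⟦ b ⟧ + ⟦ not b ⟧ ≡ 1
⟦not⟧ false = refl
⟦not⟧ true  = refl

# : (Fin n → Bool) → ℕ
# p = ∑[ i ] ⟦ p i ⟧

#+#not : (p : Fin n → Bool) → # p + # (not ∘ p) ≡ n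
#+#not {n} p = trans (sym (∑-+ _ _)) (trans (∑-cong (⟦not⟧ ∘ p)) (trans (∑-const n 1) (*-identityʳ n)))

#-split : (p q : Fin n → Bool) → # p ≤ (# λ i → q i ∧ p i) + # (not ∘ q)
#-split p q = subst (# p ≤_) (∑-+ _ _) (∑-mono λ i → lemma (p i) (q i))
  where
  lemma : ∀ b c → ⟦ b ⟧ ≤ ⟦ c ∧ b ⟧ + ⟦ not c ⟧
  lemma false c     = z≤n
  lemma true  false = s≤s z≤n
  lemma true  true  = s≤s z≤n

#-== : (v : Fin n) → (# λ u → u == v) ≡ 1
#-== {suc n} zero    = trans (∑-suc _) (cong suc (trans (∑-const n 0) (*-zeroʳ n)))
#-== {suc n} (suc v) = trans (∑-suc _) (#-== v)

-- Averaging: otherwise `g` would exceed k · B / n on all of `S`, which has at least n / k elements,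
-- and the sum over `S` would exceed `B`. The strictness is expressed by `suc (k * B)`.
pigeonhole : ∀ (S : Fin n → Bool) (g : Fin n → ℕ) k {B} → 1 ≤ n → n ≤ k * # S →
             (∑[ x ] ⟦ S x ⟧ * g x) ≤ B → ∃[ x ] T (S x) × n * g x ≤ k * B
pigeonhole {n} S g k {B} 1≤n n≤k#S ∑≤B with any? (λ x → T? (S x) ×-dec (n * g x ≤? k * B))
... | yes found = found
... | no  ¬any  = contradiction refl (<⇒≢ (begin-strict
    n * (k * B)                          <⟨ m<n+m (n * (k * B)) 1≤n ⟩
    n + n * (k * B)                      ≡⟨ *-suc n (k * B) ⟨
    n * suc (k * B)                      ≤⟨ *-monoˡ-≤ (suc (k * B)) n≤k#S ⟩
    k * # S * suc (k * B)                ≡⟨ *-assoc k (# S) _ ⟩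
    k * (# S * suc (k * B))              ≡⟨ cong (k *_) (*-comm (# S) _) ⟩
    k * (suc (k * B) * # S)              ≡⟨ cong (k *_) (∑-*ˡ (suc (k * B)) _) ⟨
    k * (∑[ x ] suc (k * B) * ⟦ S x ⟧)   ≤⟨ *-monoʳ-≤ k (∑-mono big) ⟩
    k * (∑[ x ] n * (⟦ S x ⟧ * g x))     ≡⟨ cong (k *_) (∑-*ˡ n _) ⟩
    k * (n * (∑[ x ] ⟦ S x ⟧ * g x))     ≤⟨ *-monoʳ-≤ k (*-monoʳ-≤ n ∑≤B) ⟩
    k * (n * B)                          ≡⟨ solve (k ∷ n ∷ B ∷ []) ⟩
    n * (k * B)                          ∎))
  where
  open ≤-Reasoning
  big : ∀ x → suc (k * B) * ⟦ S x ⟧ ≤ n * (⟦ S x ⟧ * g x)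
  big x with S x in eq
  ... | false = ≤-reflexive (trans (*-zeroʳ (suc (k * B))) (sym (*-zeroʳ n)))
  ... | true  = subst₂ _≤_ (sym (*-identityʳ _)) (cong (n *_) (sym (+-identityʳ (g x))))
                  (≰⇒> λ le → ¬any (x , subst T (sym eq) tt , le))

exhaust : ∀ k → (Vec Bool k → Bool) → Bool
exhaust zero    f = f Vec.[]
exhaust (suc k) f = exhaust k (f ∘ (false Vec.∷_)) ∧ exhaust k (f ∘ (true Vec.∷_))

-- Serves for inequalities between sums of indicators, which are Boolean functions of a few
-- adjacencies. All cases are evaluated by the type checker, so that `T (exhaust k f)` becomes
-- trivial.
tautology : ∀ {k} (f : Vec Bool k → Bool) → T (exhaust k f) → ∀ v → T (f v)
tautology f t Vec.[]          = t
tautology f t (false Vec.∷ v) = tautology (f ∘ (false Vec.∷_)) (proj₁ (Equivalence.to T-∧ t)) v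
tautology f t (true Vec.∷ v)  =
  tautology (f ∘ (true Vec.∷_)) (proj₂ (Equivalence.to (T-∧ {exhaust _ (f ∘ (false Vec.∷_))}) t)) v

-- Lengths of filtered lists as sums

length-filter-tabulate : {P : A → Set} (P? : ∀ a → Dec (P a)) (f : Fin n → A) →
                         length (filter P? (tabulate f)) ≡ # λ i → does (P? (f i))
length-filter-tabulate {n = zero}  P? f = sym (∑-zero _)
length-filter-tabulate {n = suc n} P? f = trans first (sym (∑-suc _))
  where
  first : length (filter P? (tabulate f)) ≡
          ⟦ does (P? (f zero)) ⟧ + # λ i → does (P? (f (suc i)))
  first with P? (f zero)
  ... | yes _ = cong suc (length-filter-tabulate P? (f ∘ suc))
  ... | no  _ = length-filter-tabulate P? (f ∘ suc)

length-filter-map : {P : B → Set} (P? : ∀ b → Dec (P b)) (f : A → B) (xs : List A) →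
                    length (filter P? (map f xs)) ≡ length (filter (P? ∘ f) xs)
length-filter-map P? f []       = refl
length-filter-map P? f (x ∷ xs) with P? (f x)
... | yes _ = cong suc (length-filter-map P? f xs)
... | no  _ = length-filter-map P? f xs

length-filter-cartesianProductWith :
  {C : Set} {P : C → Set} (P? : ∀ c → Dec (P c)) (f : A → B → C) (g : Fin n → A) (ys : List B) →
  length (filter P? (cartesianProductWith f (tabulate g) ys)) ≡
  (∑[ i ] length (filter (P? ∘ f (g i)) ys))
length-filter-cartesianProductWith {n = zero}  P? f g ys = sym (∑-zero _)
length-filter-cartesianProductWith {n = suc n} P? f g ys =
  trans (cong length (filter-++ P? (map (f (g zero)) ys) _))
  (trans (length-++ (filter P? (map (f (g zero)) ys)))
  (trans (cong₂ _+_ (length-filter-map P? (f (g zero)) ys)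
                    (length-filter-cartesianProductWith P? f (g ∘ suc) ys))
         (sym (∑-suc _))))

does-≡ : {P : Set} (P? : Dec P) (b : Bool) → (P → T b) → (T b → P) → does P? ≡ b
does-≡ (yes p) true  _ _ = refl
does-≡ (yes p) false f _ = ⊥-elim (f p)
does-≡ (no ¬p) true  _ g = contradiction (g tt) ¬p
does-≡ (no ¬p) false _ _ = refl

-- The cubic bound and its expansion

-- φ d h bounds the number of embeddings of H that send 0 to a given vertex of
-- degree d with h non-neighbours, itself included.

φ : ℕ → ℕ → ℕ
φ d h = (d ∸ 1) * d * (h ∸ 1)

-- Removes the truncated subtractions: up to a multiple of d, φ is the homogeneous cubic d²(n - d).
φ-cubic : ∀ d h → φ d (suc h) + (d + h) * d ≡ d * d * suc h
φ-cubic zero    h = *-zeroʳ h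
φ-cubic (suc d) h = identity d h
  where
  identity : ∀ d h → d * suc d * h + (suc d + h) * suc d ≡ suc d * suc d * suc h
  identity = solve-∀

∣-∣-square : ∀ a b → ∣ a - b ∣ * ∣ a - b ∣ + 2 * a * b ≡ a * a + b * b
∣-∣-square a b with ∣ a - b ∣ | ∣-∣-split a b
... | r | inj₁ refl = identity a r
  where
  identity : ∀ a r → r * r + 2 * a * (a + r) ≡ a * a + (a + r) * (a + r)
  identity = solve-∀
... | r | inj₂ refl = identity b r
  where
  identity : ∀ b r → r * r + 2 * (b + r) * b ≡ (b + r) * (b + r) + b * b
  identity = solve-∀

-- 4n³ − 27d²(n − d) = (n + 3d)(2n − 3d)², and 2n − 3d = 3h − n when n = d + h.

φ-defect : ∀ d h → let n = d + suc h; r = ∣ 3 * suc h - n ∣ in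
           27 * φ d (suc h) + 27 * ((d + h) * d) + (n + 3 * d) * (r * r) ≡ 4 * (n * n * n)
φ-defect d h = +-cancelʳ-≡ ((N + 3 * d) * (2 * (3 * suc h) * N)) _ _
  (trans (regroup (φ d (suc h)) ((d + h) * d) (N + 3 * d) (r * r) (2 * (3 * suc h) * N))
  (trans (cong₂ (λ c q → 27 * c + (N + 3 * d) * q) (φ-cubic d h) (∣-∣-square (3 * suc h) N))
         (identity d h)))
  where
  N r : ℕ
  N = d + suc h
  r = ∣ 3 * suc h - N ∣
  regroup : ∀ f g c q s → 27 * f + 27 * g + c * q + c * s ≡ 27 * (f + g) + c * (q + s)
  regroup = solve-∀
  identity : ∀ d h →
    27 * (d * d * suc h) +
      (d + suc h + 3 * d) * (3 * suc h * (3 * suc h) + (d + suc h) * (d + suc h)) ≡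
    4 * ((d + suc h) * (d + suc h) * (d + suc h)) +
      (d + suc h + 3 * d) * (2 * (3 * suc h) * (d + suc h))
  identity = solve-∀

φ-upper : ∀ d h {n} → d + h ≡ n → 1 ≤ h →
          27 * φ d h + n * (∣ 3 * h - n ∣ * ∣ 3 * h - n ∣) ≤ 4 * (n * n * n)
φ-upper d (suc h) refl _ =
  ≤-trans (m≤m+n _ _) (≤-reflexive (trans
    (identity (φ d (suc h)) (d + suc h) d (q * q) ((d + h) * d)) (φ-defect d h)))
  where
  q = ∣ 3 * suc h - (d + suc h) ∣
  identity : ∀ f n d q g → 27 * f + n * q + (27 * g + 3 * d * q) ≡ 27 * f + 27 * g + (n + 3 * d) * q
  identity = solve-∀

-- The constant is 27 + 16: `27 * ((d + h) * d)` is at most 27n², and (n + 3d)r² is at most 4n · 4 ≤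
-- 16n².
φ-lower : ∀ d h {n} → d + h ≡ n → 1 ≤ h → ∣ 3 * h - n ∣ ≤ 2 →
          4 * (n * n * n) ≤ 27 * φ d h + 43 * (n * n)
φ-lower d (suc h) refl _ r≤2 = subst (_≤ 27 * φ d (suc h) + 43 * (N * N)) (φ-defect d h)
  (linear _ (*-monoʳ-≤ (N + 3 * d) (*-mono-≤ r≤2 r≤2)) (identity (φ d (suc h)) d h ((N + 3 * d) * (r * r))))
  where
  N r : ℕ
  N = d + suc h
  r = ∣ 3 * suc h - N ∣
  identity : ∀ f d h s → let n = d + suc h in
    27 * f + 43 * (n * n) + s ≡
    27 * f + 27 * ((d + h) * d) + s + (n + 3 * d) * 4 +
      (27 * (n * suc h + d) + 16 * n * (d + h) + 12 * suc h)
  identity = solve-∀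

-- By the Taylor expansion at d′ = n − h′ the linear term of φ is at most
-- n (∣ 3h′ − n ∣ + 1) in absolute value, while the quadratic one is at most − n / 4.

private
  taylor-above : ∀ d′ τ h r → let n = d′ + τ + suc h; h′ = suc h + τ in
    8 * h′ ≤ 3 * n → 3 * h′ ≤ n + r →
    4 * φ (d′ + τ) (suc h) + n * (τ * τ) ≤ 4 * φ d′ h′ + 4 * (n * (r + 1) * τ)
  taylor-above d′ τ h r 8h′≤3n 3h′≤n+r = linear _
    (+-mono-≤ (+-mono-≤
      (+-mono-≤ (*-monoʳ-≤ 4 (≤-reflexive (sym (φ-cubic d′ (h + τ)))))
                (*-monoʳ-≤ 4 (≤-reflexive (φ-cubic (d′ + τ) h))))
      (*-monoʳ-≤ (τ * τ) 8h′≤3n)) (*-monoʳ-≤ (4 * τ * d′) 3h′≤n+r))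
    (identity (φ (d′ + τ) (suc h)) (φ d′ (suc h + τ)) d′ τ h r)
    where
    identity : ∀ f f′ d′ τ h r → let n = d′ + τ + suc h; h′ = suc h + τ; d = d′ + τ in
      4 * f′ + 4 * (n * (r + 1) * τ) +
        (4 * (d′ * d′ * h′) + 4 * (f + (d + h) * d) + τ * τ * (8 * h′) + 4 * τ * d′ * (3 * h′)) ≡
      4 * f + n * (τ * τ) +
        (4 * (f′ + (d′ + (h + τ)) * d′) + 4 * (d * d * suc h) + τ * τ * (3 * n) + 4 * τ * d′ * (n + r)) +
        (4 * τ * (n + (d + h) + h′ * r) + (4 * d′ + 4 * τ) * (τ * τ))
    identity = solve-∀

  taylor-below : ∀ d τ h′ r → let n = d + τ + suc h′ in
    8 * suc h′ ≤ 3 * n → n ≤ 3 * suc h′ + r →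
    4 * φ d (suc h′ + τ) + n * (τ * τ) ≤ 4 * φ (d + τ) (suc h′) + 4 * (n * (r + 1) * τ)
  taylor-below d τ h′ r 8h′≤3n n≤3h′+r = linear _
    (+-mono-≤ (+-mono-≤
      (+-mono-≤ (*-monoʳ-≤ 4 (≤-reflexive (sym (φ-cubic (d + τ) h′))))
                (*-monoʳ-≤ 4 (≤-reflexive (φ-cubic d (h′ + τ)))))
      (*-monoʳ-≤ (τ * τ) 8h′≤3n)) (*-monoʳ-≤ (4 * τ * (d + τ)) n≤3h′+r))
    (identity (φ d (suc h′ + τ)) (φ (d + τ) (suc h′)) d τ h′ r)
    where
    identity : ∀ f f′ d τ h′ r → let n = d + τ + suc h′; h = h′ + τ; d′ = d + τ in
      4 * f′ + 4 * (n * (r + 1) * τ) +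
        (4 * (d′ * d′ * suc h′) + 4 * (f + (d + h) * d) + τ * τ * (8 * suc h′) + 4 * τ * d′ * n) ≡
      4 * f + n * (τ * τ) +
        (4 * (f′ + (d′ + h′) * d′) + 4 * (d * d * suc h) + τ * τ * (3 * n) + 4 * τ * d′ * (3 * suc h′ + r)) +
        (4 * τ * (1 + suc h′ * r) + 4 * d * (τ * τ))
    identity = solve-∀

-- If d = d′ - τ, the cubic term is τ³ ≤ d′τ². Together with the quadratic one it is at most (2h′ -
-- n)τ², and `8 * h′ ≤ 3 * n` makes this at most - nτ² / 4. If d = d′ + τ, the cubic term is
-- negative. The `+ 1` absorbs the part of φ that is linear in d.
φ-taylor : ∀ {n} d h d′ h′ → d + h ≡ n → d′ + h′ ≡ n → 1 ≤ h → 1 ≤ h′ → 8 * h′ ≤ 3 * n →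
           let r = ∣ 3 * h′ - n ∣; τ = ∣ h - h′ ∣ in
           4 * φ d h + n * (τ * τ) ≤ 4 * φ d′ h′ + 4 * (n * (r + 1) * τ)
φ-taylor d (suc h) d′ (suc h′) d+h≡n refl _ _ 8h′≤3n
  with ∣ suc h - suc h′ ∣ | ∣-∣-split (suc h) (suc h′) | ∣-∣-ub (3 * suc h′) (d′ + suc h′)
... | τ | inj₁ refl | ub , _
  with refl ← +-cancelʳ-≡ (suc h) d (d′ + τ) (trans d+h≡n (solve (d′ ∷ h ∷ τ ∷ [])))
  rewrite sym d+h≡n = taylor-above d′ τ h _ 8h′≤3n ub
... | τ | inj₂ refl | _ , ub
  with refl ← +-cancelʳ-≡ (suc h′) d′ (d + τ) (trans (sym d+h≡n) (solve (d ∷ h′ ∷ τ ∷ []))) =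
  taylor-below d τ h′ _ 8h′≤3n ub

-- Embeddings of H

≢⇒T : {u v : Fin n} → u ≢ v → T (not (u == v))
≢⇒T {u = u} {v} u≢v with u ≟ v
... | yes u≡v = u≢v u≡v
... | no  _   = tt

T⇒≢ : {u v : Fin n} → T (not (u == v)) → u ≢ v
T⇒≢ {u = u} {v} t with u ≟ v
T⇒≢ () | yes _
...    | no u≢v = u≢v

¬⇒T-not : ∀ {b} → ¬ T b → T (not b)
¬⇒T-not {false} _  = tt
¬⇒T-not {true}  ¬t = ¬t tt

T-not⇒¬ : ∀ {b} → T (not b) → ¬ T b
T-not⇒¬ {false} _ ()

_&_ : ∀ {b c} → T b → T c → T (b ∧ c)
_&_ {true} {true} _ _ = tt

un& : ∀ {b c} → T (b ∧ c) → T b × T c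
un& {true} {true} _ = tt , tt

infixr 5 _&_

∑∑-* : ∀ {m} (f : Fin m → ℕ) (g : Fin n → ℕ) → (∑[ i ] ∑[ j ] f i * g j) ≡ ∑ f * ∑ g
∑∑-* f g = trans (∑-cong λ i → trans (∑-*ˡ (f i) g) (*-comm (f i) (∑ g)))
                 (trans (∑-*ˡ (∑ g) f) (*-comm (∑ g) (∑ f)))

length-filter-allVecs : ∀ {k} {P : Vec (Fin n) (suc k) → Set} (P? : ∀ v → Dec (P v)) →
  length (filter P? (allVecs (allFin n) (suc k))) ≡
  (∑[ i ] length (filter (P? ∘ (i Vec.∷_)) (allVecs (allFin n) k)))
length-filter-allVecs P? = length-filter-cartesianProductWith P? Vec._∷_ id _

length-filter-[[]] : {P : Vec A 0 → Set} (P? : ∀ v → Dec (P v)) →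
                     length (filter P? (Vec.[] ∷ [])) ≡ ⟦ does (P? Vec.[]) ⟧
length-filter-[[]] P? with P? Vec.[]
... | yes _ = refl
... | no  _ = refl

private
  vec₄ : Fin n → Fin n → Fin n → Fin n → Vec (Fin n) 4
  vec₄ x y z v = x Vec.∷ y Vec.∷ z Vec.∷ v Vec.∷ Vec.[]

-- Sealed, since conversion checking would otherwise unfold the enumeration.

opaque

  Λᴴ : Graph n → ℕ
  Λᴴ = Λ H

  Λᴴ≡Λ : (G : Graph n) → Λᴴ G ≡ Λ H G
  Λᴴ≡Λ G = refl

module Counting {n} (G : Graph n) where

  non : Fin n → Fin n → Bool
  non x y = not (adj G x y)

  deg codeg : Fin n → ℕ
  deg x = # (adj G x)
  codeg x = # (non x)

  -- The edge xv and the common non-neighbour y of x and v obstruct G from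
  -- being complete multipartite.

  bad : Fin n → Fin n → Fin n → Bool
  bad x y v = non x y ∧ adj G x v ∧ non y v

  ends : Fin n → ℕ
  ends x = ∑[ y ] ∑[ v ] ⟦ bad x y v ⟧

  path : Fin n → Fin n → Fin n → Bool
  path x y v = (not (x == y) ∧ non x y) ∧ adj G x v ∧ adj G y v

  paths : Fin n → ℕ
  paths x = ∑[ y ] ∑[ v ] ⟦ path x y v ⟧

  -- Vertices 0, 1, 2, 3 of H go to x, y, z, v.

  embeds : Fin n → Fin n → Fin n → Fin n → Bool
  embeds x y z v = path x y v ∧ adj G x z ∧ not (z == v)

  edge⇒≢ : ∀ {u v} → Edge G u v → u ≢ v
  edge⇒≢ {u} t refl = subst T (irrefl G u) t

  flip-edge : ∀ {u v} → Edge G u v → Edge G v u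
  flip-edge {u} {v} = subst T (symm G u v)

  module _ (x y z v : Fin n) where

    private
      f : Fin 4 → Fin n
      f = lookup (vec₄ x y z v)

    embedding⇒embeds : IsEmbedding H G f → T (embeds x y z v)
    embedding⇒embeds e =
      ((≢⇒T (proj₁ x≁y) & ¬⇒T-not (proj₂ x≁y)) & red⇒edge {0F} {3F} tt & red⇒edge {1F} {3F} tt) &
      red⇒edge {0F} {2F} tt & ≢⇒T λ z≡v → 2F≢3F (injective z≡v)
      where
      open IsEmbedding e
      x≁y = blue⇒non {0F} {1F} tt
      2F≢3F : 2F ≢ 3F
      2F≢3F ()

    embeds⇒embedding : T (embeds x y z v) → IsEmbedding H G f
    embeds⇒embedding t = record
      { injective = λ {i} {j} → inj i j
      ; red⇒edge  = λ {i} {j} → red⇒ i j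
      ; blue⇒non  = λ {i} {j} → blue⇒ i j
      }
      where
      t₁ = un& {path x y v} t
      t₂ = un& {not (x == y) ∧ non x y} (proj₁ t₁)
      x≢y = T⇒≢ (proj₁ (un& {not (x == y)} (proj₁ t₂)))
      x≁y = T-not⇒¬ (proj₂ (un& {not (x == y)} (proj₁ t₂)))
      x~v = proj₁ (un& {adj G x v} (proj₂ t₂))
      y~v = proj₂ (un& {adj G x v} (proj₂ t₂))
      x~z = proj₁ (un& {adj G x z} (proj₂ t₁))
      z≢v = T⇒≢ (proj₂ (un& {adj G x z} (proj₂ t₁)))
      y≢z : y ≢ z
      y≢z refl = x≁y x~z

      inj : ∀ i j → f i ≡ f j → i ≡ j
      inj 0F 0F _ = refl
      inj 1F 1F _ = refl
      inj 2F 2F _ = refl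
      inj 3F 3F _ = refl
      inj 0F 1F p = contradiction p x≢y
      inj 1F 0F p = contradiction (sym p) x≢y
      inj 0F 2F p = contradiction p (edge⇒≢ x~z)
      inj 2F 0F p = contradiction (sym p) (edge⇒≢ x~z)
      inj 0F 3F p = contradiction p (edge⇒≢ x~v)
      inj 3F 0F p = contradiction (sym p) (edge⇒≢ x~v)
      inj 1F 2F p = contradiction p y≢z
      inj 2F 1F p = contradiction (sym p) y≢z
      inj 1F 3F p = contradiction p (edge⇒≢ y~v)
      inj 3F 1F p = contradiction (sym p) (edge⇒≢ y~v)
      inj 2F 3F p = contradiction p z≢v
      inj 3F 2F p = contradiction (sym p) z≢v

      red⇒ : ∀ i j → Edge (red H) i j → Edge G (f i) (f j)
      red⇒ 0F 2F _ = x~z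
      red⇒ 2F 0F _ = flip-edge x~z
      red⇒ 0F 3F _ = x~v
      red⇒ 3F 0F _ = flip-edge x~v
      red⇒ 1F 3F _ = y~v
      red⇒ 3F 1F _ = flip-edge y~v
      red⇒ 2F 1F ()
      red⇒ 2F 2F ()
      red⇒ 2F 3F ()
      red⇒ 3F 2F ()
      red⇒ 3F 3F ()

      blue⇒ : ∀ i j → Edge (blue H) i j → NonEdge G (f i) (f j)
      blue⇒ 0F 1F _ = x≢y , x≁y
      blue⇒ 1F 0F _ = (λ p → x≢y (sym p)) , λ e → x≁y (flip-edge e)
      blue⇒ 1F 1F ()
      blue⇒ 1F 2F ()
      blue⇒ 1F 3F ()
      blue⇒ 2F 1F ()
      blue⇒ 2F 2F ()
      blue⇒ 2F 3F ()
      blue⇒ 3F 1F ()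
      blue⇒ 3F 2F ()
      blue⇒ 3F 3F ()

  #-remove : ∀ (p : Fin n → Bool) v → T (p v) → (# λ z → p z ∧ not (z == v)) ≡ # p ∸ 1
  #-remove p v pv = sym (trans (cong (_∸ 1) eq) (m+n∸n≡m _ 1))
    where
    split : ∀ z → ⟦ p z ⟧ ≡ ⟦ p z ∧ not (z == v) ⟧ + ⟦ z == v ⟧
    split z with z ≟ v
    split z | yes refl with p z
    ... | true = refl
    split z | no _ with p z
    ... | true  = refl
    ... | false = refl
    eq : # p ≡ (# λ z → p z ∧ not (z == v)) + 1
    eq = trans (∑-cong split) (trans (∑-+ _ _) (cong (_+_ _) (#-== v)))

  -- Once x, y and v are fixed, z ranges over the neighbours of x other than v. That z differs from
  -- y is automatic, as y is no neighbour of x.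
  Λ-sum : Λᴴ G ≡ ∑[ x ] (deg x ∸ 1) * paths x
  Λ-sum = trans (Λᴴ≡Λ G) $
    trans (length-filter-allVecs (λ v → isEmbedding? H G (lookup v))) (∑-cong λ x →
    trans (trans (length-filter-allVecs (λ v → isEmbedding? H G (lookup (x Vec.∷ v)))) (∑-cong λ y →
    trans (trans (length-filter-allVecs (λ v → isEmbedding? H G (lookup (x Vec.∷ y Vec.∷ v)))) (∑-cong λ z →
    trans (length-filter-allVecs (λ v → isEmbedding? H G (lookup (x Vec.∷ y Vec.∷ z Vec.∷ v)))) (∑-cong λ v →
    trans (length-filter-[[]] (λ u → isEmbedding? H G (lookup (x Vec.∷ y Vec.∷ z Vec.∷ v Vec.∷ u))))
      (cong ⟦_⟧ (does-≡ (isEmbedding? H G (lookup (vec₄ x y z v))) (embeds x y z v)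
        (embedding⇒embeds x y z v) (embeds⇒embedding x y z v))))))
    -- The enumeration sums over z before v; here z becomes the inner variable.
    (trans (∑-swap _) (∑-cong λ v → choices x y v))))
    (trans (∑-cong λ y → ∑-*ˡ (deg x ∸ 1) _) (∑-*ˡ (deg x ∸ 1) _)))
    where
    choices : ∀ x y v → (∑[ z ] ⟦ embeds x y z v ⟧) ≡ (deg x ∸ 1) * ⟦ path x y v ⟧
    choices x y v with path x y v in eq
    ... | false = trans (∑-const n 0) (trans (*-zeroʳ n) (sym (*-zeroʳ (deg x ∸ 1))))
    ... | true  = trans (#-remove (adj G x) v
                          (proj₁ (un& {adj G x v} (proj₂ (un& {not (x == y) ∧ non x y} (subst T (sym eq) tt))))))
                        (sym (*-identityʳ _))

  deg+codeg : ∀ x → deg x + codeg x ≡ n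
  deg+codeg x = #+#not (adj G x)

  1≤codeg : ∀ x → 1 ≤ codeg x
  1≤codeg x = ≤-trans (≤-reflexive (sym (cong (⟦_⟧ ∘ not) (irrefl G x)))) (≤∑ (⟦_⟧ ∘ non x) x)

  -- Take a non-neighbour y and a neighbour v of x. If y and v are adjacent they give a path, if not
  -- a bad triple. The exception y = x occurs `deg x` times, which accounts for the `∸ 1`.
  paths+ends : ∀ x → paths x + ends x ≡ deg x * (codeg x ∸ 1)
  paths+ends x = +-cancelʳ-≡ (deg x) _ _ (trans total (sym (predecessor (codeg x) (1≤codeg x))))
    where
    predecessor : ∀ h → 1 ≤ h → deg x * (h ∸ 1) + deg x ≡ deg x * h
    predecessor (suc h) _ = trans (+-comm _ (deg x)) (sym (*-suc (deg x) h))

    pointwise : ∀ y v → ⟦ non x y ⟧ * ⟦ adj G x v ⟧ ≡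
                ⟦ path x y v ⟧ + ⟦ bad x y v ⟧ + ⟦ y == x ⟧ * ⟦ adj G x v ⟧
    pointwise y v rewrite ==-sym y x with x ≟ y
    pointwise y v | yes refl rewrite irrefl G x with adj G x v
    ... | true  = refl
    ... | false = refl
    pointwise y v | no _ with adj G x y | adj G x v | adj G y v
    ... | true  | _     | _     = refl
    ... | false | false | _     = refl
    ... | false | true  | false = refl
    ... | false | true  | true  = refl

    total : paths x + ends x + deg x ≡ deg x * codeg x
    total = sym (trans (*-comm (deg x) _) (trans (sym (∑∑-* _ _))
      (trans (∑-cong λ y → trans (∑-cong (pointwise y)) (trans (∑-+ _ _) (cong₂ _+_ (∑-+ _ _) refl)))
      (trans (trans (∑-+ _ _) (cong₂ _+_ (∑-+ _ _) refl))
      (cong (_+_ _) (trans (∑∑-* _ _) (trans (cong₂ _*_ (#-== x) refl) (+-identityʳ _))))))))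

  weighted-ends : ℕ
  weighted-ends = ∑[ x ] (deg x ∸ 1) * ends x

  Λ+weighted-ends : Λᴴ G + weighted-ends ≡ ∑[ x ] φ (deg x) (codeg x)
  Λ+weighted-ends = trans (cong (_+ weighted-ends) Λ-sum) (trans (sym (∑-+ _ _)) (∑-cong λ x →
    trans (sym (*-distribˡ-+ (deg x ∸ 1) (paths x) (ends x)))
    (trans (cong ((deg x ∸ 1) *_) (paths+ends x)) (sym (*-assoc (deg x ∸ 1) (deg x) _)))))

  dev : Fin n → ℕ
  dev x = ∣ 3 * codeg x - n ∣

  -- The second and third terms vanish when G is complete multipartite and
  -- when all its degrees are 2n / 3, respectively.

  Λ-upper : 27 * Λᴴ G + 27 * weighted-ends + n * (∑[ x ] dev x * dev x) ≤ 4 * (n * (n * n * n))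
  Λ-upper = begin
    27 * Λᴴ G + 27 * weighted-ends + n * (∑[ x ] dev x * dev x)
      ≡⟨ cong₂ _+_ (trans (sym (*-distribˡ-+ 27 (Λᴴ G) weighted-ends)) (cong (27 *_) Λ+weighted-ends)) (sym (∑-*ˡ n _)) ⟩
    27 * (∑[ x ] φ (deg x) (codeg x)) + (∑[ x ] n * (dev x * dev x))
      ≡⟨ cong₂ _+_ (∑-*ˡ 27 _) refl ⟨
    (∑[ x ] 27 * φ (deg x) (codeg x)) + (∑[ x ] n * (dev x * dev x))
      ≡⟨ ∑-+ _ _ ⟨
    (∑[ x ] (27 * φ (deg x) (codeg x) + n * (dev x * dev x)))
      ≤⟨ ∑-mono (λ x → φ-upper (deg x) (codeg x) (deg+codeg x) (1≤codeg x)) ⟩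
    ∑ {n} (λ _ → 4 * (n * n * n))
      ≡⟨ ∑-const n _ ⟩
    n * (4 * (n * n * n))
      ≡⟨ solve (n ∷ []) ⟩
    4 * (n * (n * n * n)) ∎
    where open ≤-Reasoning

-- Blowups of K₃

part : (Fin n → Fin 3) → Fin 3 → ℕ
part p i = # λ u → p u == i

partSize≡part : (p : Fin n → Fin 3) → ∀ i → partSize p i ≡ part p i
partSize≡part p i = length-filter-tabulate (λ u → p u ≟ i) id

differ : Graph n → Graph n → Fin n → Fin n → Bool
differ G G′ u v = adj G u v xor adj G′ u v

-- Ordered pairs are counted, so this is 2 ∣ E(G) △ E(G′) ∣.

distance : Graph n → Graph n → ℕ
distance G G′ = ∑[ u ] ∑[ v ] ⟦ differ G G′ u v ⟧

symDiff≤distance : (G G′ : Graph n) → symDiff G G′ ≤ distance G G′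
symDiff≤distance {n} G G′ = begin
  symDiff G G′
    ≡⟨ length-filter-cartesianProductWith differ? _,_ id (allFin n) ⟩
  (∑[ u ] length (filter (λ v → differ? (u , v)) (allFin n)))
    ≡⟨ ∑-cong (λ u → length-filter-tabulate (λ v → differ? (u , v)) id) ⟩
  (∑[ u ] ∑[ v ] ⟦ does (differ? (u , v)) ⟧)
    ≤⟨ ∑-mono (λ u → ∑-mono λ v → pointwise (does (u <? v)) (adj G u v) (adj G′ u v)) ⟩
  distance G G′ ∎
  where
  open ≤-Reasoning
  differ? : (uv : Fin n × Fin n) → Dec _
  differ? (u , v) = (u <? v) ×-dec ¬? (adj G u v ≟ᵇ adj G′ u v)
  pointwise : ∀ b c d → ⟦ b ∧ not (does (c ≟ᵇ d)) ⟧ ≤ ⟦ c xor d ⟧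
  pointwise false _     _     = z≤n
  pointwise true  false false = z≤n
  pointwise true  false true  = s≤s z≤n
  pointwise true  true  false = s≤s z≤n
  pointwise true  true  true  = z≤n

editDistance≤distance : (G G′ : Graph n) → editDistance G G′ ≤ distance G G′
editDistance≤distance {n} G G′ = ≤-trans
  (Extrema.min≤⊤ ≤-totalOrder (symDiff G G′) (map (λ v → symDiffAlong (lookup v) G G′) (bijections n)))
  (symDiff≤distance G G′)

distance≤n² : (G G′ : Graph n) → distance G G′ ≤ n * n
distance≤n² {n} G G′ = ≤-trans
  (∑-mono λ u → ≤-trans (∑-mono λ v → ⟦⟧-mono {differ G G′ u v} {true} _)
    (≤-reflexive (trans (∑-const n 1) (*-identityʳ n))))
  (≤-reflexive (∑-const n n))

module _ {n} (p : Fin n → Fin 3) where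

  open Counting (blowup K₃ p)

  codeg-blowup : ∀ x → codeg x ≡ part p (p x)
  codeg-blowup x = ∑-cong λ y → cong ⟦_⟧ (trans (not-involutive (p x == p y)) (==-sym (p x) (p y)))

  -- Non-adjacency in a blowup of K₃ means lying in the same part, hence is transitive.
  not-bad-blowup : ∀ x y v → bad x y v ≡ false
  not-bad-blowup x y v with p x ≟ p y | p y ≟ p v
  ... | no  _     | _       = refl
  ... | yes _     | no  _   = ∧-zeroʳ _
  ... | yes px≡py | yes py≡pv with p x ≟ p v
  ...   | yes _     = refl
  ...   | no  px≢pv = contradiction (trans px≡py py≡pv) px≢pv

  Λ-blowup : Λᴴ (blowup K₃ p) ≡ ∑[ x ] φ (deg x) (codeg x)
  Λ-blowup = trans (sym (+-identityʳ _)) (trans (cong (_+_ (Λᴴ (blowup K₃ p))) (sym no-ends)) Λ+weighted-ends)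
    where
    no-ends : weighted-ends ≡ 0
    no-ends = trans (∑-cong λ x → trans (cong ((deg x ∸ 1) *_)
      (trans (∑-cong λ y → trans (∑-cong λ v → cong ⟦_⟧ (not-bad-blowup x y v)) (∑-0 n)) (∑-0 n)))
      (*-zeroʳ (deg x ∸ 1))) (∑-0 n)
      where
      ∑-0 : ∀ n → ∑ {n} (λ _ → 0) ≡ 0
      ∑-0 n = trans (∑-const n 0) (*-zeroʳ n)

  -- In `Λ-upper` only the deviations of the vertices in part i are kept; each of them equals r.
  part-upper : ∀ i → let r = ∣ 3 * part p i - n ∣ in
               27 * Λᴴ (blowup K₃ p) + n * (part p i * (r * r)) ≤ 4 * (n * (n * n * n))
  part-upper i = ≤-trans (+-mono-≤ (m≤m+n _ (27 * weighted-ends)) (*-monoʳ-≤ n (begin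
    part p i * (r * r)                  ≡⟨ *-comm (part p i) _ ⟩
    r * r * part p i                    ≡⟨ ∑-*ˡ (r * r) _ ⟨
    (∑[ x ] r * r * ⟦ p x == i ⟧)       ≤⟨ ∑-mono pointwise ⟩
    (∑[ x ] dev x * dev x)              ∎))) Λ-upper
    where
    open ≤-Reasoning
    r = ∣ 3 * part p i - n ∣
    pointwise : ∀ x → r * r * ⟦ p x == i ⟧ ≤ dev x * dev x
    pointwise x with p x ≟ i
    ... | no  _    = ≤-trans (≤-reflexive (*-zeroʳ (r * r))) z≤n
    ... | yes refl = ≤-reflexive (trans (*-identityʳ (r * r))
                       (cong (λ s → ∣ 3 * s - n ∣ * ∣ 3 * s - n ∣) (sym (codeg-blowup x))))

-- Comparing a graph with a nearly balanced blowup

module Comparison {n} (G : Graph n) (p : Fin n → Fin 3) where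

  private
    module G = Counting G
    module G′ = Counting (blowup K₃ p)

  shift : Fin n → ℕ
  shift x = ∣ G.codeg x - G′.codeg x ∣

  ∑shift≤distance : ∑ shift ≤ distance G (blowup K₃ p)
  ∑shift≤distance = ∑-mono λ x → ≤-trans (∣∑-∑∣≤ _ _) (∑-mono λ v → pointwise (adj G x v) (adj (blowup K₃ p) x v))
    where
    pointwise : ∀ b c → ∣ ⟦ not b ⟧ - ⟦ not c ⟧ ∣ ≤ ⟦ b xor c ⟧
    pointwise false false = z≤n
    pointwise false true  = s≤s z≤n
    pointwise true  false = s≤s z≤n
    pointwise true  true  = z≤n

  -- `φ-taylor` is summed over all vertices. The balance hypothesis turns the linear term at x into
  -- at most 4n² / L times `shift x`, and the shifts add up to at most the distance.
  comparison : ∀ L → (∀ i → L * (∣ 3 * part p i - n ∣ + 1) ≤ n) → (∀ i → 8 * part p i ≤ 3 * n) →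
    L * (4 * Λᴴ G + 4 * Counting.weighted-ends G + n * (∑[ x ] shift x * shift x)) ≤
    L * (4 * Λᴴ (blowup K₃ p)) + 4 * (n * n) * distance G (blowup K₃ p)
  comparison L balanced small = begin
    L * (4 * Λᴴ G + 4 * G.weighted-ends + n * (∑[ x ] shift x * shift x))
      ≡⟨ cong (L *_) (cong₂ _+_ (trans (sym (*-distribˡ-+ 4 (Λᴴ G) G.weighted-ends))
           (trans (cong (4 *_) G.Λ+weighted-ends) (sym (∑-*ˡ 4 _)))) (sym (∑-*ˡ n _))) ⟩
    L * ((∑[ x ] 4 * φ (G.deg x) (G.codeg x)) + (∑[ x ] n * (shift x * shift x)))
      ≡⟨ cong (L *_) (∑-+ _ _) ⟨
    L * (∑[ x ] (4 * φ (G.deg x) (G.codeg x) + n * (shift x * shift x)))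
      ≡⟨ ∑-*ˡ L _ ⟨
    (∑[ x ] L * (4 * φ (G.deg x) (G.codeg x) + n * (shift x * shift x)))
      ≤⟨ ∑-mono pointwise ⟩
    (∑[ x ] (L * 4 * φ (G′.deg x) (G′.codeg x) + 4 * (n * n) * shift x))
      ≡⟨ trans (∑-+ _ _) (cong₂ _+_ (∑-*ˡ (L * 4) _) (∑-*ˡ (4 * (n * n)) _)) ⟩
    L * 4 * (∑[ x ] φ (G′.deg x) (G′.codeg x)) + 4 * (n * n) * ∑ shift
      ≤⟨ +-mono-≤ (≤-reflexive (trans (*-assoc L 4 _) (cong (λ l → L * (4 * l)) (sym (Λ-blowup p)))))
                  (*-monoʳ-≤ (4 * (n * n)) ∑shift≤distance) ⟩
    L * (4 * Λᴴ (blowup K₃ p)) + 4 * (n * n) * distance G (blowup K₃ p) ∎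
    where
    open ≤-Reasoning
    pointwise : ∀ x → L * (4 * φ (G.deg x) (G.codeg x) + n * (shift x * shift x)) ≤
                      L * 4 * φ (G′.deg x) (G′.codeg x) + 4 * (n * n) * shift x
    pointwise x = linear 0 (+-mono-≤ (*-monoʳ-≤ L taylor) (*-monoʳ-≤ (4 * n * τ) bal))
      (identity L (4 * φ (G.deg x) (G.codeg x) + n * (shift x * shift x)) (φ (G′.deg x) (G′.codeg x)) n r τ)
      where
      r = ∣ 3 * G′.codeg x - n ∣
      τ = shift x
      bal : L * (r + 1) ≤ n
      bal = subst (λ s → L * (∣ 3 * s - n ∣ + 1) ≤ n) (sym (codeg-blowup p x)) (balanced (p x))
      taylor = φ-taylor (G.deg x) (G.codeg x) (G′.deg x) (G′.codeg x)
        (G.deg+codeg x) (G′.deg+codeg x) (G.1≤codeg x) (G′.1≤codeg x)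
        (subst (λ s → 8 * s ≤ 3 * n) (sym (codeg-blowup p x)) (small (p x)))
      identity : ∀ L a f n r τ →
        L * 4 * f + 4 * (n * n) * τ + (L * a + 4 * n * τ * (L * (r + 1))) ≡
        L * a + (L * (4 * f + 4 * (n * (r + 1) * τ)) + 4 * n * τ * n) + 0
      identity = solve-∀

-- Turán graphs

rotate : Fin 3 → Fin 3
rotate 0F = 1F
rotate 1F = 2F
rotate 2F = 0F

-- Vertex u gets class u mod 3. In this recursive form a new vertex only rotates the sizes of the
-- parts and increases one of them.
turán : ∀ n → Fin n → Fin 3
turán (suc n) zero    = 0F
turán (suc n) (suc u) = rotate (turán n u)

part-turán-suc : ∀ n i → part (turán (suc n)) (rotate i) ≡ ⟦ 0F == rotate i ⟧ + part (turán n) i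
part-turán-suc n i = trans (∑-suc _) (cong (_+_ _) (∑-cong λ u → cong ⟦_⟧ (injective (turán n u) i)))
  where
  injective : ∀ j i → (rotate j == rotate i) ≡ (j == i)
  injective = from-yes (all? λ j → all? λ i → (rotate j == rotate i) ≟ᵇ (j == i))

Balanced : ℕ → (ℕ → ℕ → ℕ → Set)
Balanced n a b c = ∃[ k ] ((n ≡ 3 * k × a ≡ k × b ≡ k × c ≡ k)
                         ⊎ (n ≡ 1 + 3 * k × a ≡ 1 + k × b ≡ k × c ≡ k)
                         ⊎ (n ≡ 2 + 3 * k × a ≡ 1 + k × b ≡ 1 + k × c ≡ k))

balanced-turán : ∀ n → Balanced n (part (turán n) 0F) (part (turán n) 1F) (part (turán n) 2F)
balanced-turán zero = 0 , inj₁ (refl , ∑-zero _ , ∑-zero _ , ∑-zero _)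
balanced-turán (suc n)
  rewrite part-turán-suc n 0F | part-turán-suc n 1F | part-turán-suc n 2F with balanced-turán n
... | k , inj₁ (n≡ , a≡ , b≡ , c≡) =
  k , inj₂ (inj₁ (cong suc n≡ , cong suc c≡ , a≡ , b≡))
... | k , inj₂ (inj₁ (n≡ , a≡ , b≡ , c≡)) =
  k , inj₂ (inj₂ (cong suc n≡ , cong suc c≡ , a≡ , b≡))
... | k , inj₂ (inj₂ (n≡ , a≡ , b≡ , c≡)) =
  suc k , inj₁ (trans (cong suc n≡) (solve (k ∷ [])) , cong suc c≡ , a≡ , b≡)

part-turán : ∀ n i → ∣ 3 * part (turán n) i - n ∣ ≤ 2
part-turán n i with balanced-turán n
... | k , inj₁ (n≡ , a≡ , b≡ , c≡) = near i
  where
  even : ∣ 3 * k - 3 * k ∣ ≤ 2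
  even = ∣-∣-lub (3 * k) (3 * k) (m≤m+n _ 2) (m≤m+n _ 2)
  near : ∀ i → ∣ 3 * part (turán n) i - n ∣ ≤ 2
  near 0F = subst₂ (λ s m → ∣ 3 * s - m ∣ ≤ 2) (sym a≡) (sym n≡) even
  near 1F = subst₂ (λ s m → ∣ 3 * s - m ∣ ≤ 2) (sym b≡) (sym n≡) even
  near 2F = subst₂ (λ s m → ∣ 3 * s - m ∣ ≤ 2) (sym c≡) (sym n≡) even
... | k , inj₂ (inj₁ (n≡ , a≡ , b≡ , c≡)) = near i
  where
  large : ∣ 3 * (1 + k) - (1 + 3 * k) ∣ ≤ 2
  large = ∣-∣-lub (3 * (1 + k)) (1 + 3 * k) (≤-reflexive (solve (k ∷ []))) (linear 4 (≤-refl {0}) (solve (k ∷ [])))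
  small : ∣ 3 * k - (1 + 3 * k) ∣ ≤ 2
  small = ∣-∣-lub (3 * k) (1 + 3 * k) (linear 3 (≤-refl {0}) (solve (k ∷ []))) (linear 1 (≤-refl {0}) (solve (k ∷ [])))
  near : ∀ i → ∣ 3 * part (turán n) i - n ∣ ≤ 2
  near 0F = subst₂ (λ s m → ∣ 3 * s - m ∣ ≤ 2) (sym a≡) (sym n≡) large
  near 1F = subst₂ (λ s m → ∣ 3 * s - m ∣ ≤ 2) (sym b≡) (sym n≡) small
  near 2F = subst₂ (λ s m → ∣ 3 * s - m ∣ ≤ 2) (sym c≡) (sym n≡) small
... | k , inj₂ (inj₂ (n≡ , a≡ , b≡ , c≡)) = near i
  where
  large : ∣ 3 * (1 + k) - (2 + 3 * k) ∣ ≤ 2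
  large = ∣-∣-lub (3 * (1 + k)) (2 + 3 * k) (linear 1 (≤-refl {0}) (solve (k ∷ []))) (linear 3 (≤-refl {0}) (solve (k ∷ [])))
  small : ∣ 3 * k - (2 + 3 * k) ∣ ≤ 2
  small = ∣-∣-lub (3 * k) (2 + 3 * k) (linear 4 (≤-refl {0}) (solve (k ∷ []))) (≤-reflexive (solve (k ∷ [])))
  near : ∀ i → ∣ 3 * part (turán n) i - n ∣ ≤ 2
  near 0F = subst₂ (λ s m → ∣ 3 * s - m ∣ ≤ 2) (sym a≡) (sym n≡) large
  near 1F = subst₂ (λ s m → ∣ 3 * s - m ∣ ≤ 2) (sym b≡) (sym n≡) large
  near 2F = subst₂ (λ s m → ∣ 3 * s - m ∣ ≤ 2) (sym c≡) (sym n≡) small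

-- Without bad triples the only loss against 4n⁴ / 27 comes from the degrees, and `φ-lower` bounds
-- it at each vertex.
Λ-turán : ∀ n → 4 * (n * (n * n * n)) ≤ 27 * Λᴴ (blowup K₃ (turán n)) + 43 * (n * n * n)
Λ-turán n = begin
  4 * (n * (n * n * n))
    ≡⟨ trans (∑-const n _) (solve (n ∷ [])) ⟨
  ∑ {n} (λ _ → 4 * (n * n * n))
    ≤⟨ ∑-mono (λ x → φ-lower (deg x) (codeg x) (deg+codeg x) (1≤codeg x)
         (subst (λ s → ∣ 3 * s - n ∣ ≤ 2) (sym (codeg-blowup (turán n) x)) (part-turán n (turán n x)))) ⟩
  (∑[ x ] (27 * φ (deg x) (codeg x) + 43 * (n * n)))
    ≡⟨ trans (∑-+ _ _) (cong₂ _+_ (∑-*ˡ 27 _) (∑-const n _)) ⟩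
  27 * (∑[ x ] φ (deg x) (codeg x)) + n * (43 * (n * n))
    ≡⟨ cong₂ _+_ (cong (27 *_) (sym (Λ-blowup (turán n)))) (solve (n ∷ [])) ⟩
  27 * Λᴴ (blowup K₃ (turán n)) + 43 * (n * n * n) ∎
  where
  open ≤-Reasoning
  open Counting (blowup K₃ (turán n))

-- Pivots

infixl 4 _⊕_
infixr 5 _⊗_

_⊕_ : ∀ {a b c d} → a ≤ b → c ≤ d → a + c ≤ b + d
_⊕_ = +-mono-≤

_⊗_ : ∀ k {a b} → a ≤ b → k * a ≤ k * b
_⊗_ = *-monoʳ-≤

linear* : ∀ k .{{_ : NonZero k}} {l r L R} p → l ≤ r → k * R + l ≡ k * L + r + p → L ≤ R
linear* k p l≤r eq = *-cancelˡ-≤ k (linear p l≤r eq)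

≤ᵇ-false : ∀ a b → (a ≤ᵇ b) ≡ false → b < a
≤ᵇ-false a b eq = ≰⇒> λ a≤b → subst T eq (≤⇒≤ᵇ a≤b)

-- K is the precision of the degrees of the pivots. A deficit of at most
-- n⁴ / 24K² leaves at most n / 24 vertices that are not tight. Fairness only
-- requires a degree between 7n / 12 and 3n / 4.

module Pivots {n} (G : Graph n) (K : ℕ) (K-large : 55296 ≤ K) (K≤n : K ≤ n)
  (deficit : 24 * (K * K) * (27 * Counting.weighted-ends G + n * (∑[ x ] Counting.dev G x * Counting.dev G x))
             ≤ n * (n * n * n)) where

  open Counting G

  instance
    n≢0 : NonZero n
    n≢0 = >-nonZero (≤-trans (≤-trans (≤ᵇ⇒≤ 1 55296 _) K-large) K≤n)

    n²≢0 : NonZero (n * n)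
    n²≢0 = m*n≢0 n n

    n³≢0 : NonZero (n * n * n)
    n³≢0 = m*n≢0 (n * n) n

  tight fair : Fin n → Bool
  tight x = K * dev x ≤ᵇ n
  fair x = 4 * dev x ≤ᵇ n

  tight-≤ : ∀ {k} x → k ≤ 55296 → T (tight x) → k * dev x ≤ n
  tight-≤ x k≤ t = ≤-trans (*-monoˡ-≤ (dev x) (≤-trans k≤ K-large)) (≤ᵇ⇒≤ _ n t)

  tight⇒fair : ∀ x → T (tight x) → T (fair x)
  tight⇒fair x t = ≤⇒≤ᵇ (tight-≤ x (≤ᵇ⇒≤ 4 55296 _) t)

  fair⇒n≤4codeg : ∀ x → T (fair x) → n ≤ 4 * codeg x
  fair⇒n≤4codeg x t = arith n (codeg x) (dev x) (≤ᵇ⇒≤ _ n t) (proj₂ (∣-∣-ub (3 * codeg x) n))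
    where
    arith : ∀ n h r → 4 * r ≤ n → n ≤ 3 * h + r → n ≤ 4 * h
    arith n h r p q = linear* 3 0 (p ⊕ 4 ⊗ q) (solve (n ∷ h ∷ r ∷ []))

  fair⇒7n≤12deg : ∀ x → T (fair x) → 7 * n ≤ 12 * deg x
  fair⇒7n≤12deg x t =
    arith n (deg x) (codeg x) (dev x) (deg+codeg x) (≤ᵇ⇒≤ _ n t) (proj₁ (∣-∣-ub (3 * codeg x) n))
    where
    arith : ∀ n d h r → d + h ≡ n → 4 * r ≤ n → 3 * h ≤ n + r → 7 * n ≤ 12 * d
    arith n d h r refl p q = linear 0 (p ⊕ 4 ⊗ q) (solve (d ∷ h ∷ r ∷ []))

  fair⇒n≤2[deg-1] : ∀ x → T (fair x) → n ≤ 2 * (deg x ∸ 1)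
  fair⇒n≤2[deg-1] x t = subst (n ≤_) (sym (*-distribˡ-∸ 2 (deg x) 1))
    (m+n≤o⇒m≤o∸n n (arith n (deg x) (fair⇒7n≤12deg x t)
      (≤-trans (≤-trans (≤ᵇ⇒≤ 12 55296 _) K-large) K≤n)))
    where
    arith : ∀ n d → 7 * n ≤ 12 * d → 12 ≤ n → n + 2 ≤ 2 * d
    arith n d p q = linear* 6 0 (p ⊕ q) (solve (n ∷ d ∷ []))

  #untight #unfair M : ℕ
  #untight = # (not ∘ tight)
  #unfair = # (not ∘ fair)
  M = ∑[ x ] ⟦ fair x ⟧ * ends x

  -- Chebyshev's inequality: an untight vertex adds at least n² / K² to the sum of the squared
  -- deviations, which is at most n³ / 24K² by `deficit`.
  24#untight≤n : 24 * #untight ≤ n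
  24#untight≤n = *-cancelʳ-≤ (24 * #untight) n (n * n * n)
    (arith n K #untight weighted-ends (∑[ x ] dev x * dev x) untight deficit)
    where
    pointwise : ∀ x → n * n * ⟦ not (tight x) ⟧ ≤ K * K * (dev x * dev x)
    pointwise x with tight x in eq
    ... | true  = ≤-trans (≤-reflexive (*-zeroʳ (n * n))) z≤n
    ... | false = subst₂ _≤_ (sym (*-identityʳ (n * n))) ([m*n]*[o*p]≡[m*o]*[n*p] K (dev x) K (dev x))
      (*-mono-≤ (<⇒≤ (≤ᵇ-false (K * dev x) n eq)) (<⇒≤ (≤ᵇ-false (K * dev x) n eq)))
    untight : n * n * #untight ≤ K * K * (∑[ x ] dev x * dev x)
    untight = subst₂ _≤_ (∑-*ˡ (n * n) _) (∑-*ˡ (K * K) _) (∑-mono pointwise)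
    arith : ∀ n K u w s → n * n * u ≤ K * K * s →
            24 * (K * K) * (27 * w + n * s) ≤ n * (n * n * n) → 24 * u * (n * n * n) ≤ n * (n * n * n)
    arith n K u w s p q = linear (24 * (K * K) * (27 * w)) (24 * n ⊗ p ⊕ q) (solve (n ∷ K ∷ u ∷ w ∷ s ∷ []))

  -- At a fair vertex the weight `deg x ∸ 1` in `weighted-ends` is at least n / 2.
  nM≤2weighted-ends : n * M ≤ 2 * weighted-ends
  nM≤2weighted-ends = subst₂ _≤_ (∑-*ˡ n _) (∑-*ˡ 2 _) (∑-mono pointwise)
    where
    pointwise : ∀ x → n * (⟦ fair x ⟧ * ends x) ≤ 2 * ((deg x ∸ 1) * ends x)
    pointwise x with fair x in eq
    ... | false = ≤-trans (≤-reflexive (*-zeroʳ n)) z≤n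
    ... | true  = subst₂ _≤_ (cong (n *_) (sym (+-identityʳ (ends x)))) (*-assoc 2 (deg x ∸ 1) _)
      (*-monoˡ-≤ (ends x) (fair⇒n≤2[deg-1] x (subst T (sym eq) _)))

  M-small : 24 * (K * K) * M ≤ n * n * n
  M-small = *-cancelˡ-≤ n (arith n (24 * (K * K)) M weighted-ends (∑[ x ] dev x * dev x) nM≤2weighted-ends deficit)
    where
    arith : ∀ n κ m w s → n * m ≤ 2 * w → κ * (27 * w + n * s) ≤ n * (n * n * n) →
            n * (κ * m) ≤ n * (n * n * n)
    arith n κ m w s p q = linear (κ * (25 * w + n * s)) (κ ⊗ p ⊕ q) (solve (n ∷ κ ∷ m ∷ w ∷ s ∷ []))

  -- M counts the bad triples by their fair ends. For a pivot x, cost x counts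
  -- those that contain x as an end or, with a fair end v, as the middle vertex.

  central : Fin n → Fin n → Fin n → Bool
  central x v w = fair v ∧ non x v ∧ non x w ∧ adj G v w

  centres cost : Fin n → ℕ
  centres x = ∑[ v ] ∑[ w ] ⟦ central x v w ⟧
  cost x = ends x + centres x

  shared : Fin n → Fin n → ℕ
  shared x y = # λ v → non x v ∧ non y v

  -- For fair v, `central x v w` is `bad v x w`, so the triples counted by `M` are merely regrouped
  -- by their middle vertex x.
  ∑centres≡M : ∑ centres ≡ M
  ∑centres≡M = trans (∑-swap _) (∑-cong λ v →
    trans (∑-cong λ x → trans (∑-cong λ w → pointwise x v w) (∑-*ˡ ⟦ fair v ⟧ _)) (∑-*ˡ ⟦ fair v ⟧ _))
    where
    pointwise : ∀ x v w → ⟦ central x v w ⟧ ≡ ⟦ fair v ⟧ * ⟦ bad v x w ⟧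
    pointwise x v w = trans (⟦∧⟧ (fair v) _) (cong (⟦ fair v ⟧ *_) lemma)
      where
      lemma : ⟦ non x v ∧ non x w ∧ adj G v w ⟧ ≡ ⟦ bad v x w ⟧
      lemma rewrite symm G x v with adj G v x | adj G x w | adj G v w
      ... | true  | _     | _     = refl
      ... | false | true  | true  = refl
      ... | false | true  | false = refl
      ... | false | false | true  = refl
      ... | false | false | false = refl

  ∑tight-cost≤2M : (∑[ x ] ⟦ tight x ⟧ * cost x) ≤ 2 * M
  ∑tight-cost≤2M = begin
    (∑[ x ] ⟦ tight x ⟧ * cost x)            ≤⟨ ∑-mono pointwise ⟩
    (∑[ x ] (⟦ fair x ⟧ * ends x + centres x)) ≡⟨ trans (∑-+ _ _) (cong (_+_ M) ∑centres≡M) ⟩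
    M + M                                    ≡⟨ cong (_+_ M) (+-identityʳ M) ⟨
    2 * M                                    ∎
    where
    open ≤-Reasoning
    pointwise : ∀ x → ⟦ tight x ⟧ * cost x ≤ ⟦ fair x ⟧ * ends x + centres x
    pointwise x with tight x in eq
    ... | false = z≤n
    ... | true with fair x in eq′
    ...   | true  = ≤-reflexive (trans (+-identityʳ _) (cong (_+ centres x) (sym (+-identityʳ _))))
    ...   | false = ⊥-elim (subst T eq′ (tight⇒fair x (subst T (sym eq) _)))

  -- An edge xy with a common non-neighbour v is the bad triple `bad x v y`. Hence a vertex with few
  -- `ends` shares few non-neighbours with its neighbours on average.
  ∑shared≡ends : ∀ x → (∑[ y ] ⟦ adj G x y ⟧ * shared x y) ≡ ends x
  ∑shared≡ends x = trans (∑-cong λ y → sym (∑-*ˡ ⟦ adj G x y ⟧ _))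
    (trans (∑-swap _) (∑-cong λ v → ∑-cong λ y → pointwise v y))
    where
    pointwise : ∀ v y → ⟦ adj G x y ⟧ * ⟦ non x v ∧ non y v ⟧ ≡ ⟦ bad x v y ⟧
    pointwise v y rewrite symm G v y with adj G x y | adj G x v | adj G y v
    ... | false | true  | _     = refl
    ... | false | false | _     = refl
    ... | true  | true  | _     = refl
    ... | true  | false | true  = refl
    ... | true  | false | false = refl

  1≤n : 1 ≤ n
  1≤n = ≤-trans (≤-trans (≤ᵇ⇒≤ 1 55296 _) K-large) K≤n

  -- The constants add up the three averaging bounds 2 · 2M, 2 · 6M and 4 · 18M: 88 = 4 + 12 + 72
  -- and 84 = 12 + 72. The adjacency of the pivots is recorded through its effect, the small number
  -- of shared non-neighbours.
  record Triangle : Set where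
    field
      a b c       : Fin n
      tight-a     : T (tight a)
      tight-b     : T (tight b)
      tight-c     : T (tight c)
      n*cost≤     : n * (cost a + cost b + cost c) ≤ 88 * M
      n²*shared≤ : n * n * (shared a b + (shared a c + shared b c)) ≤ 84 * M

  private
    enough : ∀ {n} s u → s + u ≡ n → 24 * u ≤ n → n ≤ 2 * s
    enough s u refl p = linear* 24 (22 * s + 22 * u) (2 ⊗ p) (solve (s ∷ u ∷ []))

    arith-b : ∀ n d u s → d ≤ s + u → 24 * u ≤ n → 7 * n ≤ 12 * d → n ≤ 2 * s
    arith-b n d u s p q r = linear* 12 n (24 ⊗ p ⊕ q ⊕ 2 ⊗ r) (solve (n ∷ d ∷ u ∷ s ∷ []))

    -- Two tight vertices have at least 11n / 36 common neighbours. At most n / 24 of these are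
    -- untight, which leaves 19n / 72 ≥ n / 4.
    arith-c : ∀ n ha hb ra rb u q s → n ≤ q + ha + hb → q ≤ s + u → 24 * u ≤ n →
              3 * ha ≤ n + ra → 3 * hb ≤ n + rb → 24 * ra ≤ n → 24 * rb ≤ n → n ≤ 4 * s
    arith-c n ha hb ra rb u q s p₁ p₂ p₃ p₄ p₅ p₆ p₇ = linear* 18 n
      (72 ⊗ p₁ ⊕ 72 ⊗ p₂ ⊕ 3 ⊗ p₃ ⊕ 24 ⊗ p₄ ⊕ 24 ⊗ p₅ ⊕ p₆ ⊕ p₇)
      (solve (n ∷ ha ∷ hb ∷ ra ∷ rb ∷ u ∷ q ∷ s ∷ []))

    cover : ∀ a b → n ≤ (# λ y → adj G a y ∧ adj G b y) + codeg a + codeg b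
    cover a b = begin
      n                                                     ≡⟨ trans (∑-const n 1) (*-identityʳ n) ⟨
      ∑ {n} (λ _ → 1)                                       ≤⟨ ∑-mono (λ y → pointwise (adj G a y) (adj G b y)) ⟩
      (∑[ y ] (⟦ adj G a y ∧ adj G b y ⟧ + ⟦ non a y ⟧ + ⟦ non b y ⟧)) ≡⟨ trans (∑-+ _ _) (cong₂ _+_ (∑-+ _ _) refl) ⟩
      (# λ y → adj G a y ∧ adj G b y) + codeg a + codeg b   ∎
      where
      open ≤-Reasoning
      pointwise : ∀ s t → 1 ≤ ⟦ s ∧ t ⟧ + ⟦ not s ⟧ + ⟦ not t ⟧
      pointwise true  true  = s≤s z≤n
      pointwise true  false = s≤s z≤n
      pointwise false _     = s≤s z≤n

    -- Costs are of order n² and numbers of shared non-neighbours of order n. With the weight n both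
    -- are controlled by a single averaging.
    ∑-choice : ∀ (q : Fin n → Bool) (o : Fin n → ℕ) →
      (∑[ y ] ⟦ tight y ∧ q y ⟧ * (cost y + n * o y)) ≤ 2 * M + n * (∑[ y ] ⟦ q y ⟧ * o y)
    ∑-choice q o = begin
      (∑[ y ] ⟦ tight y ∧ q y ⟧ * (cost y + n * o y))
        ≤⟨ ∑-mono (λ y → pointwise (tight y) (q y) (cost y) (o y)) ⟩
      (∑[ y ] (⟦ tight y ⟧ * cost y + n * (⟦ q y ⟧ * o y)))
        ≡⟨ trans (∑-+ _ _) (cong (_+_ _) (∑-*ˡ n _)) ⟩
      (∑[ y ] ⟦ tight y ⟧ * cost y) + n * (∑[ y ] ⟦ q y ⟧ * o y)
        ≤⟨ +-monoˡ-≤ _ ∑tight-cost≤2M ⟩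
      2 * M + n * (∑[ y ] ⟦ q y ⟧ * o y) ∎
      where
      open ≤-Reasoning
      pointwise : ∀ s t k o → ⟦ s ∧ t ⟧ * (k + n * o) ≤ ⟦ s ⟧ * k + n * (⟦ t ⟧ * o)
      pointwise false t     k o = z≤n
      pointwise true  false k o = z≤n
      pointwise true  true  k o = ≤-reflexive (solve (n ∷ k ∷ o ∷ []))

    n*ends≤ : ∀ x {k} g → n * (cost x + g) ≤ k → n * ends x ≤ k
    n*ends≤ x g = ≤-trans (*-monoʳ-≤ n (≤-trans (m≤m+n _ (centres x)) (m≤m+n _ g)))

    sum-b : ∀ a → n * cost a ≤ 2 * (2 * M) →
      (∑[ y ] ⟦ tight y ∧ adj G a y ⟧ * (cost y + n * shared a y)) ≤ 6 * M
    sum-b a p = ≤-trans (∑-choice (adj G a) (shared a))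
      (≤-trans (+-monoʳ-≤ (2 * M) (subst (λ e → n * e ≤ 2 * (2 * M)) (sym (∑shared≡ends a))
        (≤-trans (*-monoʳ-≤ n (m≤m+n _ (centres a))) p)))
      (≤-reflexive (arith M)))
      where
      arith : ∀ m → 2 * m + 2 * (2 * m) ≡ 6 * m
      arith = solve-∀

    -- 18 = 2 + 4 + 12, from the costs of the candidates, from `ends a` and from `ends b`.
    sum-c : ∀ a b → n * cost a ≤ 2 * (2 * M) → n * (cost b + n * shared a b) ≤ 2 * (6 * M) →
      (∑[ y ] ⟦ tight y ∧ adj G a y ∧ adj G b y ⟧ * (cost y + n * (shared a y + shared b y))) ≤ 18 * M
    sum-c a b p q = ≤-trans (∑-choice (λ y → adj G a y ∧ adj G b y) (λ y → shared a y + shared b y))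
      (≤-trans (+-monoʳ-≤ (2 * M) (*-monoʳ-≤ n (begin
        (∑[ y ] ⟦ adj G a y ∧ adj G b y ⟧ * (shared a y + shared b y))
          ≤⟨ ∑-mono (λ y → pointwise (adj G a y) (adj G b y) (shared a y) (shared b y)) ⟩
        (∑[ y ] (⟦ adj G a y ⟧ * shared a y + ⟦ adj G b y ⟧ * shared b y))
          ≡⟨ trans (∑-+ _ _) (cong₂ _+_ (∑shared≡ends a) (∑shared≡ends b)) ⟩
        ends a + ends b ∎)))
      (arith n (ends a) (ends b) M (≤-trans (*-monoʳ-≤ n (m≤m+n _ (centres a))) p) (n*ends≤ b _ q)))
      where
      open ≤-Reasoning
      pointwise : ∀ s t j k → ⟦ s ∧ t ⟧ * (j + k) ≤ ⟦ s ⟧ * j + ⟦ t ⟧ * k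
      pointwise false t     j k = z≤n
      pointwise true  false j k = z≤n
      pointwise true  true  j k = ≤-reflexive (solve (j ∷ k ∷ []))
      arith : ∀ n e f m → n * e ≤ 2 * (2 * m) → n * f ≤ 2 * (6 * m) → 2 * m + n * (e + f) ≤ 18 * m
      arith n e f m p q = linear 0 (p ⊕ q) (solve (n ∷ e ∷ f ∷ m ∷ []))

    arith-cost : ∀ n ca cb cc o o′ m → n * ca ≤ 2 * (2 * m) → n * (cb + n * o) ≤ 2 * (6 * m) →
      n * (cc + n * o′) ≤ 4 * (18 * m) → n * (ca + cb + cc) ≤ 88 * m
    arith-cost n ca cb cc o o′ m p q r =
      linear (n * (n * (o + o′))) (p ⊕ q ⊕ r) (solve (n ∷ ca ∷ cb ∷ cc ∷ o ∷ o′ ∷ m ∷ []))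

    arith-shared : ∀ n cb cc o o′ m → n * (cb + n * o) ≤ 2 * (6 * m) →
      n * (cc + n * o′) ≤ 4 * (18 * m) → n * n * (o + o′) ≤ 84 * m
    arith-shared n cb cc o o′ m q r =
      linear (n * (cb + cc)) (q ⊕ r) (solve (n ∷ cb ∷ cc ∷ o ∷ o′ ∷ m ∷ []))

    choose-c : ∀ a b → T (tight a) → T (tight b) →
      n * cost a ≤ 2 * (2 * M) → n * (cost b + n * shared a b) ≤ 2 * (6 * M) →
      ∃[ c ] T (tight c ∧ adj G a c ∧ adj G b c) × n * (cost c + n * (shared a c + shared b c)) ≤ 4 * (18 * M) →
      Triangle
    choose-c a b tight-a tight-b p q (c , S-c , r) = record
      { tight-a = tight-a ; tight-b = tight-b ; tight-c = proj₁ (un& {tight c} S-c)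
      ; n*cost≤ = arith-cost n (cost a) (cost b) (cost c) (shared a b) (shared a c + shared b c) M p q r
      ; n²*shared≤ = arith-shared n (cost b) (cost c) (shared a b) (shared a c + shared b c) M q r
      }

    choose-b : ∀ a → T (tight a) → n * cost a ≤ 2 * (2 * M) →
      ∃[ b ] T (tight b ∧ adj G a b) × n * (cost b + n * shared a b) ≤ 2 * (6 * M) → Triangle
    choose-b a tight-a p (b , S-b , q) = choose-c a b tight-a tight-b p q
      (pigeonhole (λ y → tight y ∧ adj G a y ∧ adj G b y)
        (λ y → cost y + n * (shared a y + shared b y)) 4 1≤n
        (arith-c n (codeg a) (codeg b) (dev a) (dev b) #untight _ _ (cover a b)
          (#-split (λ y → adj G a y ∧ adj G b y) tight) 24#untight≤n
          (proj₁ (∣-∣-ub (3 * codeg a) n)) (proj₁ (∣-∣-ub (3 * codeg b) n))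
          (tight-≤ a (≤ᵇ⇒≤ 24 55296 _) tight-a) (tight-≤ b (≤ᵇ⇒≤ 24 55296 _) tight-b))
        (sum-c a b p q))
      where
      tight-b : T (tight b)
      tight-b = proj₁ (un& {tight b} S-b)

    choose-a : ∃[ a ] T (tight a) × n * cost a ≤ 2 * (2 * M) → Triangle
    choose-a (a , tight-a , p) = choose-b a tight-a p
      (pigeonhole (λ y → tight y ∧ adj G a y) (λ y → cost y + n * shared a y) 2 1≤n
        (arith-b n (deg a) #untight _ (#-split (adj G a) tight) 24#untight≤n
          (fair⇒7n≤12deg a (tight⇒fair a tight-a)))
        (sum-b a p))

  triangle : Triangle
  triangle = choose-a (pigeonhole tight cost 2 1≤n
    (enough (# tight) #untight (#+#not tight) 24#untight≤n) ∑tight-cost≤2M)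

-- The partition given by the pivots

colour : Bool → Bool → Fin 3
colour false _     = 0F
colour true  false = 1F
colour true  true  = 2F

∑-+₃ : (f g h : Fin n → ℕ) → (∑[ i ] (f i + (g i + h i))) ≡ ∑ f + (∑ g + ∑ h)
∑-+₃ f g h = trans (∑-+ f _) (cong (_+_ (∑ f)) (∑-+ g h))

module Partition {n} (G : Graph n) (K : ℕ) (K-large : 55296 ≤ K) (K≤n : K ≤ n)
  (deficit : 24 * (K * K) * (27 * Counting.weighted-ends G + n * (∑[ x ] Counting.dev G x * Counting.dev G x))
             ≤ n * (n * n * n))
  (t : Pivots.Triangle G K K-large K≤n deficit) where

  open Counting G
  open Pivots G K K-large K≤n deficit
  open Triangle t

  partition : Fin n → Fin 3
  partition v = colour (adj G a v) (adj G b v)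

  total-shared total-ends total-cost ρ : ℕ
  total-shared = shared a b + (shared a c + shared b c)
  total-ends = ends a + (ends b + ends c)
  total-cost = cost a + cost b + cost c
  ρ = dev a + dev b + 3 * total-shared

  -- The bounds on shared non-neighbours and on `M` give K² · `total-shared` ≤ 7n / 2; one factor K
  -- absorbs the constant.
  K*total-shared≤n : K * total-shared ≤ n
  K*total-shared≤n = *-cancelʳ-≤ (K * total-shared) n (n * n)
    (arith n K total-shared M (≤-trans (≤ᵇ⇒≤ 4 55296 _) K-large) n²*shared≤ M-small)
    where
    arith : ∀ n K o m → 4 ≤ K → n * n * o ≤ 84 * m → 24 * (K * K) * m ≤ n * n * n →
            K * o * (n * n) ≤ n * (n * n)
    arith n K o m p q r = linear* 96 (12 * (n * n * n))
      (24 * K * o * (n * n) ⊗ p ⊕ (24 * (K * K) ⊗ q ⊕ 84 ⊗ r)) (solve (n ∷ K ∷ o ∷ m ∷ []))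

  -- Each of 1, `dev a`, `dev b` and `total-shared` is at most n / K, the last one counts three
  -- times, and 55296 = 6 · 9216.
  9216[ρ+1]≤n : 9216 * (ρ + 1) ≤ n
  9216[ρ+1]≤n = arith n K (dev a) (dev b) total-shared K≤n K-large (≤ᵇ⇒≤ _ n tight-a) (≤ᵇ⇒≤ _ n tight-b) K*total-shared≤n
    where
    arith : ∀ n K r s o → K ≤ n → 55296 ≤ K → K * r ≤ n → K * s ≤ n → K * o ≤ n →
            9216 * (r + s + 3 * o + 1) ≤ n
    arith n K r s o p q u v w = linear* 6 0 (p ⊕ (r + s + 3 * o + 1) ⊗ q ⊕ u ⊕ v ⊕ 3 ⊗ w)
      (solve (n ∷ K ∷ r ∷ s ∷ o ∷ []))

  parts-sum : part partition 0F + (part partition 1F + part partition 2F) ≡ n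
  parts-sum = trans (sym (∑-+₃ {n} _ _ _))
    (trans (∑-cong λ v → pointwise (adj G a v) (adj G b v)) (trans (∑-const n 1) (*-identityʳ n)))
    where
    pointwise : ∀ s t → ⟦ colour s t == 0F ⟧ + (⟦ colour s t == 1F ⟧ + ⟦ colour s t == 2F ⟧) ≡ 1
    pointwise false _     = refl
    pointwise true  false = refl
    pointwise true  true  = refl

  part₀ : part partition 0F ≡ codeg a
  part₀ = ∑-cong λ v → pointwise (adj G a v) (adj G b v)
    where
    pointwise : ∀ s t → ⟦ colour s t == 0F ⟧ ≡ ⟦ not s ⟧
    pointwise false _     = refl
    pointwise true  false = refl
    pointwise true  true  = refl

  part₁ : part partition 1F + shared a b ≡ codeg b
  part₁ = trans (sym (∑-+ _ _)) (∑-cong λ v → pointwise (adj G a v) (adj G b v))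
    where
    pointwise : ∀ s t → ⟦ colour s t == 1F ⟧ + ⟦ not s ∧ not t ⟧ ≡ ⟦ not t ⟧
    pointwise false false = refl
    pointwise false true  = refl
    pointwise true  false = refl
    pointwise true  true  = refl

  -- Part 0 consists of the non-neighbours of a, part 1 of those of b that are not shared with a,
  -- and part 2 is the rest. The errors of all three are collected in `ρ`.
  near-third : ∀ i → 3 * part partition i ≤ n + ρ × n ≤ 3 * part partition i + ρ
  near-third = λ where
      0F → near₀ _ _ _ (dev b) total-shared part₀ (∣-∣-ub (3 * codeg a) n)
      1F → near₁ _ _ (dev a) _ (shared a b) (shared a c + shared b c) part₁ (∣-∣-ub (3 * codeg b) n)
      2F → near₂ _ _ _ _ _ (dev a) (dev b) (shared a b) (shared a c + shared b c) parts-sum part₀ part₁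
             (∣-∣-ub (3 * codeg a) n) (∣-∣-ub (3 * codeg b) n)
    where
    near₀ : ∀ s₀ ha r r′ o → s₀ ≡ ha → 3 * ha ≤ n + r × n ≤ 3 * ha + r →
            3 * s₀ ≤ n + (r + r′ + 3 * o) × n ≤ 3 * s₀ + (r + r′ + 3 * o)
    near₀ s₀ _ r r′ o refl (p , q) =
      linear (r′ + 3 * o) p (solve (n ∷ s₀ ∷ r ∷ r′ ∷ o ∷ [])) ,
      linear (r′ + 3 * o) q (solve (n ∷ s₀ ∷ r ∷ r′ ∷ o ∷ []))
    near₁ : ∀ s₁ hb r r′ o o′ → s₁ + o ≡ hb → 3 * hb ≤ n + r′ × n ≤ 3 * hb + r′ →
            3 * s₁ ≤ n + (r + r′ + 3 * (o + o′)) × n ≤ 3 * s₁ + (r + r′ + 3 * (o + o′))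
    near₁ s₁ _ r r′ o o′ refl (p , q) =
      linear (r + 3 * o + 3 * (o + o′)) p (solve (n ∷ s₁ ∷ r ∷ r′ ∷ o ∷ o′ ∷ [])) ,
      linear (r + 3 * o′) q (solve (n ∷ s₁ ∷ r ∷ r′ ∷ o ∷ o′ ∷ []))
    near₂ : ∀ {n} s₀ s₁ s₂ ha hb r r′ o o′ → s₀ + (s₁ + s₂) ≡ n → s₀ ≡ ha → s₁ + o ≡ hb →
            3 * ha ≤ n + r × n ≤ 3 * ha + r → 3 * hb ≤ n + r′ × n ≤ 3 * hb + r′ →
            3 * s₂ ≤ n + (r + r′ + 3 * (o + o′)) × n ≤ 3 * s₂ + (r + r′ + 3 * (o + o′))
    near₂ s₀ s₁ s₂ _ _ r r′ o o′ refl refl refl (p , q) (p′ , q′) =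
      linear (3 * o′) (q ⊕ q′) (solve (s₀ ∷ s₁ ∷ s₂ ∷ r ∷ r′ ∷ o ∷ o′ ∷ [])) ,
      linear (3 * o + 3 * (o + o′)) (p ⊕ p′) (solve (s₀ ∷ s₁ ∷ s₂ ∷ r ∷ r′ ∷ o ∷ o′ ∷ []))

  -- These vertices are adjacent to all pivots. They end up in class 2 without being tied to the
  -- pivot c, so they must be shown to be few.
  remote : Fin n → Bool
  remote v = adj G a v ∧ adj G b v ∧ adj G c v

  -- By inclusion and exclusion the three sets of non-neighbours nearly cover the graph. The
  -- deviations of their sizes and their overlaps each leave at most n / 16 vertices.
  8#remote≤n : 8 * # remote ≤ n
  8#remote≤n = arith n (# remote) (codeg a) (codeg b) (codeg c) (dev a) (dev b) (dev c) total-shared inclusion-exclusion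
    (proj₂ (∣-∣-ub (3 * codeg a) n)) (proj₂ (∣-∣-ub (3 * codeg b) n)) (proj₂ (∣-∣-ub (3 * codeg c) n))
    (tight-≤ a (≤ᵇ⇒≤ 16 55296 _) tight-a) (tight-≤ b (≤ᵇ⇒≤ 16 55296 _) tight-b) (tight-≤ c (≤ᵇ⇒≤ 16 55296 _) tight-c)
    (≤-trans (*-monoˡ-≤ total-shared (≤-trans (≤ᵇ⇒≤ 16 55296 _) K-large)) K*total-shared≤n)
    where
    pointwise : ∀ s t u → ⟦ s ∧ t ∧ u ⟧ + (⟦ not s ⟧ + (⟦ not t ⟧ + ⟦ not u ⟧)) ≤
                1 + (⟦ not s ∧ not t ⟧ + (⟦ not s ∧ not u ⟧ + ⟦ not t ∧ not u ⟧))
    pointwise s t u = ≤ᵇ⇒≤ _ _ (tautology {3} f _ (s Vec.∷ t Vec.∷ u Vec.∷ Vec.[]))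
      where
      f : Vec Bool 3 → Bool
      f (s Vec.∷ t Vec.∷ u Vec.∷ Vec.[]) =
        (⟦ s ∧ t ∧ u ⟧ + (⟦ not s ⟧ + (⟦ not t ⟧ + ⟦ not u ⟧))) ≤ᵇ
        (1 + (⟦ not s ∧ not t ⟧ + (⟦ not s ∧ not u ⟧ + ⟦ not t ∧ not u ⟧)))
    inclusion-exclusion : # remote + (codeg a + (codeg b + codeg c)) ≤ n + total-shared
    inclusion-exclusion = subst₂ _≤_
      (trans (∑-+ _ _) (cong (_+_ (# remote)) (∑-+₃ _ _ _)))
      (trans (∑-+ _ _) (cong₂ _+_ (trans (∑-const n 1) (*-identityʳ n)) (∑-+₃ _ _ _)))
      (∑-mono λ v → pointwise (adj G a v) (adj G b v) (adj G c v))
    arith : ∀ n R h h′ h″ r r′ r″ o → R + (h + (h′ + h″)) ≤ n + o →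
      n ≤ 3 * h + r → n ≤ 3 * h′ + r′ → n ≤ 3 * h″ + r″ →
      16 * r ≤ n → 16 * r′ ≤ n → 16 * r″ ≤ n → 16 * o ≤ n → 8 * R ≤ n
    arith n R h h′ h″ r r′ r″ o p q q′ q″ u u′ u″ w =
      linear* 6 0 (48 ⊗ p ⊕ (16 ⊗ q ⊕ 16 ⊗ q′ ⊕ 16 ⊗ q″) ⊕ (u ⊕ u′ ⊕ u″) ⊕ 3 ⊗ w)
        (solve (n ∷ R ∷ h ∷ h′ ∷ h″ ∷ r ∷ r′ ∷ r″ ∷ o ∷ []))

  remote-fair : Fin n → Bool
  remote-fair v = remote v ∧ fair v

  -- A non-neighbour v of a remote vertex w is either remote itself or
  -- completes a bad triple with the pivot of its class.

  n*#remote-fair≤ : n * # remote-fair ≤ 8 * total-ends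
  n*#remote-fair≤ = arith n (# remote-fair) (# remote) total-ends escape 8#remote≤n
    where
    pointwise : ∀ w v → ⟦ remote-fair w ⟧ * ⟦ non w v ⟧ ≤
      ⟦ bad a v w ⟧ + (⟦ bad b v w ⟧ + ⟦ bad c v w ⟧) + ⟦ remote-fair w ⟧ * ⟦ remote v ⟧
    pointwise w v rewrite symm G v w = ≤ᵇ⇒≤ _ _ (tautology {8} f _
      (adj G a v Vec.∷ adj G b v Vec.∷ adj G c v Vec.∷ adj G a w Vec.∷ adj G b w Vec.∷ adj G c w Vec.∷
       adj G w v Vec.∷ fair w Vec.∷ Vec.[]))
      where
      f : Vec Bool 8 → Bool
      f (av Vec.∷ bv Vec.∷ cv Vec.∷ aw Vec.∷ bw Vec.∷ cw Vec.∷ wv Vec.∷ fw Vec.∷ Vec.[]) =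
        (⟦ (aw ∧ bw ∧ cw) ∧ fw ⟧ * ⟦ not wv ⟧) ≤ᵇ
        (⟦ not av ∧ aw ∧ not wv ⟧ + (⟦ not bv ∧ bw ∧ not wv ⟧ + ⟦ not cv ∧ cw ∧ not wv ⟧) +
          ⟦ (aw ∧ bw ∧ cw) ∧ fw ⟧ * ⟦ av ∧ bv ∧ cv ⟧)

    swap-ends : ∀ x → (∑[ w ] ∑[ v ] ⟦ bad x v w ⟧) ≡ ends x
    swap-ends x = ∑-swap _

    crossing : (∑[ w ] ⟦ remote-fair w ⟧ * codeg w) ≤ total-ends + # remote-fair * # remote
    crossing = begin
      (∑[ w ] ⟦ remote-fair w ⟧ * codeg w)
        ≡⟨ ∑-cong (λ w → ∑-*ˡ ⟦ remote-fair w ⟧ _) ⟨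
      (∑[ w ] ∑[ v ] ⟦ remote-fair w ⟧ * ⟦ non w v ⟧)
        ≤⟨ ∑-mono (λ w → ∑-mono λ v → pointwise w v) ⟩
      (∑[ w ] ∑[ v ] (⟦ bad a v w ⟧ + (⟦ bad b v w ⟧ + ⟦ bad c v w ⟧) + ⟦ remote-fair w ⟧ * ⟦ remote v ⟧))
        ≡⟨ ∑-cong (λ w → trans (∑-+ _ _) (cong₂ _+_ (∑-+₃ _ _ _) refl)) ⟩
      (∑[ w ] ((∑[ v ] ⟦ bad a v w ⟧) + ((∑[ v ] ⟦ bad b v w ⟧) + (∑[ v ] ⟦ bad c v w ⟧)) +
        (∑[ v ] ⟦ remote-fair w ⟧ * ⟦ remote v ⟧)))
        ≡⟨ trans (∑-+ _ _) (cong₂ _+_ (trans (∑-+₃ _ _ _)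
             (cong₂ _+_ (swap-ends a) (cong₂ _+_ (swap-ends b) (swap-ends c)))) (∑∑-* _ _)) ⟩
      total-ends + # remote-fair * # remote ∎
      where open ≤-Reasoning

    escape : n * # remote-fair ≤ 4 * (total-ends + # remote-fair * # remote)
    escape = ≤-trans (subst₂ _≤_ (∑-*ˡ n _) (∑-*ˡ 4 _) (∑-mono large)) (*-monoʳ-≤ 4 crossing)
      where
      large : ∀ w → n * ⟦ remote-fair w ⟧ ≤ 4 * (⟦ remote-fair w ⟧ * codeg w)
      large w with remote-fair w in eq
      ... | false = ≤-trans (≤-reflexive (*-zeroʳ n)) z≤n
      ... | true  = subst₂ _≤_ (sym (*-identityʳ n)) (cong (4 *_) (sym (+-identityʳ (codeg w))))
                      (fair⇒n≤4codeg w (proj₂ (un& {remote w} (subst T (sym eq) _))))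

    -- As 8R ≤ n, the term 4FR is at most half of the left-hand side nF and is absorbed.
    arith : ∀ n F R e → n * F ≤ 4 * (e + F * R) → 8 * R ≤ n → n * F ≤ 8 * e
    arith n F R e p q = linear 0 (2 ⊗ p ⊕ F ⊗ q) (solve (n ∷ F ∷ R ∷ e ∷ []))

  private
    module G′ = Counting (blowup K₃ partition)

    -- The bad triples of the first line pay for a missing edge between two classes, those of the
    -- second for an edge inside a class.
    charge : Fin n → Fin n → ℕ
    charge u v = ⟦ bad a u v ⟧ + (⟦ bad b u v ⟧ + ⟦ bad c u v ⟧) +
                 (⟦ central a u v ⟧ + (⟦ central b u v ⟧ + ⟦ central c u v ⟧))

    -- When a wrong pair {u, v} consists of fair vertices that are not
    -- remote, it completes a bad triple with the pivot of the class of u or v.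

    differ-≤ : ∀ u v → ⟦ differ G (blowup K₃ partition) u v ⟧ ≤
      (⟦ not (fair u) ⟧ + ⟦ not (fair v) ⟧) + (charge u v + charge v u) + (⟦ remote-fair u ⟧ + ⟦ remote-fair v ⟧)
    differ-≤ u v rewrite symm G v u = ≤ᵇ⇒≤ _ _ (tautology {9} f _
      (adj G a u Vec.∷ adj G b u Vec.∷ adj G c u Vec.∷ adj G a v Vec.∷ adj G b v Vec.∷ adj G c v Vec.∷
       adj G u v Vec.∷ fair u Vec.∷ fair v Vec.∷ Vec.[]))
      where
      f : Vec Bool 9 → Bool
      f (au Vec.∷ bu Vec.∷ cu Vec.∷ av Vec.∷ bv Vec.∷ cv Vec.∷ uv Vec.∷ fu Vec.∷ fv Vec.∷ Vec.[]) =
        ⟦ uv xor not (colour au bu == colour av bv) ⟧ ≤ᵇ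
        ((⟦ not fu ⟧ + ⟦ not fv ⟧) +
         (⟦ not au ∧ av ∧ not uv ⟧ + (⟦ not bu ∧ bv ∧ not uv ⟧ + ⟦ not cu ∧ cv ∧ not uv ⟧) +
           (⟦ fu ∧ not au ∧ not av ∧ uv ⟧ + (⟦ fu ∧ not bu ∧ not bv ∧ uv ⟧ + ⟦ fu ∧ not cu ∧ not cv ∧ uv ⟧)) +
          (⟦ not av ∧ au ∧ not uv ⟧ + (⟦ not bv ∧ bu ∧ not uv ⟧ + ⟦ not cv ∧ cu ∧ not uv ⟧) +
           (⟦ fv ∧ not av ∧ not au ∧ uv ⟧ + (⟦ fv ∧ not bv ∧ not bu ∧ uv ⟧ + ⟦ fv ∧ not cv ∧ not cu ∧ uv ⟧)))) +
         (⟦ (au ∧ bu ∧ cu) ∧ fu ⟧ + ⟦ (av ∧ bv ∧ cv) ∧ fv ⟧))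

    ∑∑-symmetric : (g : Fin n → ℕ) → (∑[ u ] ∑[ v ] (g u + g v)) ≡ 2 * (n * ∑ g)
    ∑∑-symmetric g = trans (∑-cong λ u → trans (∑-+ _ _) (cong₂ _+_ (∑-const n (g u)) refl))
      (trans (∑-+ _ _) (cong₂ _+_ (∑-*ˡ n g) (trans (∑-const n (∑ g)) (sym (+-identityʳ _)))))

    ∑∑-charge : (∑[ u ] ∑[ v ] charge u v) ≡ total-cost
    ∑∑-charge = trans (∑-cong λ u → trans (∑-+ _ _) (cong₂ _+_ (∑-+₃ _ _ _) (∑-+₃ _ _ _)))
      (trans (∑-+ _ _) (trans (cong₂ _+_ (∑-+₃ _ _ _) (∑-+₃ _ _ _))
        (regroup (ends a) (ends b) (ends c) (centres a) (centres b) (centres c))))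
      where
      regroup : ∀ x y z x′ y′ z′ → x + (y + z) + (x′ + (y′ + z′)) ≡ x + x′ + (y + y′) + (z + z′)
      regroup = solve-∀

  distance≤ : distance G (blowup K₃ partition) ≤ 2 * (n * #unfair) + 2 * total-cost + 2 * (n * # remote-fair)
  distance≤ = ≤-trans (∑-mono λ u → ∑-mono λ v → differ-≤ u v) (≤-reflexive
    (trans (∑-cong λ u → trans (∑-+ _ _) (cong₂ _+_ (∑-+ _ _) refl))
    (trans (∑-+ _ _) (cong₂ _+_
      (trans (∑-+ _ _) (cong₂ _+_ (∑∑-symmetric (⟦_⟧ ∘ not ∘ fair))
        (trans (∑-cong λ u → ∑-+ _ _) (trans (∑-+ _ _)
          (trans (cong₂ _+_ ∑∑-charge (trans (∑-swap _) ∑∑-charge)) (cong (_+_ total-cost) (sym (+-identityʳ _))))))))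
      (∑∑-symmetric (⟦_⟧ ∘ remote-fair))))))

  open Comparison G partition using (shift; comparison)

  -- An unfair vertex deviates by more than n / 4 in G but by at most n / 9216 in the blowup. Its
  -- shift is therefore at least n / 24, and 576 = 24².
  n²*#unfair≤ : n * n * #unfair ≤ 576 * (∑[ x ] shift x * shift x)
  n²*#unfair≤ = subst₂ _≤_ (∑-*ˡ (n * n) _) (∑-*ˡ 576 _) (∑-mono pointwise)
    where
    dev′ : ∀ x → 9216 * G′.dev x ≤ n
    dev′ x = ≤-trans (*-monoʳ-≤ 9216 (≤-trans (≤-reflexive (cong (λ s → ∣ 3 * s - n ∣) (codeg-blowup partition x)))
      (≤-trans (∣-∣-lub (3 * part partition i) n (proj₁ (near-third i)) (proj₂ (near-third i))) (m≤m+n ρ 1)))) 9216[ρ+1]≤n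
      where i = partition x
    dev≤ : ∀ x → dev x ≤ 3 * shift x + G′.dev x
    dev≤ x = subst (λ s → dev x ≤ s + G′.dev x) (sym (*-distribˡ-∣-∣ 3 (codeg x) (G′.codeg x)))
      (∣-∣-triangle (3 * codeg x) (3 * G′.codeg x) n)
    arith : ∀ n r r′ s → n ≤ 4 * r → r ≤ 3 * s + r′ → 9216 * r′ ≤ n → n ≤ 24 * s
    arith n r r′ s p q w = linear* 2304 (2302 * n) (4608 ⊗ p ⊕ 18432 ⊗ q ⊕ 2 ⊗ w) (solve (n ∷ r ∷ r′ ∷ s ∷ []))
    pointwise : ∀ x → n * n * ⟦ not (fair x) ⟧ ≤ 576 * (shift x * shift x)
    pointwise x with fair x in eq
    ... | true  = ≤-trans (≤-reflexive (*-zeroʳ (n * n))) z≤n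
    ... | false = subst₂ _≤_ (sym (*-identityʳ (n * n))) ([m*n]*[o*p]≡[m*o]*[n*p] 24 (shift x) 24 (shift x))
      (*-mono-≤ far far)
      where
      far : n ≤ 24 * shift x
      far = arith n (dev x) (G′.dev x) (shift x) (<⇒≤ (≤ᵇ-false (4 * dev x) n eq)) (dev≤ x) (dev′ x)

-- The gain of the blowup over G

private
  large-part : ∀ n ρ s → n ≤ 3 * s + ρ → 9216 * (ρ + 1) ≤ n → n ≤ 6 * s
  large-part n ρ s p q = linear* 4608 (4607 * n + 9216) (9216 ⊗ p ⊕ q) (solve (n ∷ ρ ∷ s ∷ []))

  small-part : ∀ n ρ s → 3 * s ≤ n + ρ → 9216 * (ρ + 1) ≤ n → 8 * s ≤ 3 * n
  small-part n ρ s p q = linear* 3456 (1151 * n + 9216) (9216 ⊗ p ⊕ q) (solve (n ∷ ρ ∷ s ∷ []))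

  -- Costs enter directly with factor 2 and through the remote vertices with factor 2 · 8, and 18 ·
  -- 88 = 1584.
  distance-arith : ∀ n E Z C e F m → E ≤ 2 * (n * Z) + 2 * C + 2 * (n * F) → n * F ≤ 8 * e → e ≤ C →
          n * C ≤ 88 * m → n * E ≤ 2 * (n * n * Z) + 1584 * m
  distance-arith n E Z C e F m p q r s = linear 0 (n ⊗ p ⊕ 2 * n ⊗ q ⊕ 16 * n ⊗ r ⊕ 18 ⊗ s)
    (solve (n ∷ E ∷ Z ∷ C ∷ e ∷ F ∷ m ∷ []))

  -- 9216 = 16 · 576 is chosen so that the quadratic terms and the bad triples together pay for
  -- 8n²E. The linear terms consume 4n²E of this; the other half is the gain.
  gain-arith : ∀ n y x w s E Z m →
    9216 * (4 * y + 4 * w + n * s) ≤ 9216 * (4 * x) + 4 * (n * n) * E →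
    n * E ≤ 2 * (n * n * Z) + 1584 * m → n * m ≤ 2 * w → n * n * Z ≤ 576 * s →
    9216 * y + n * n * E ≤ 9216 * x
  gain-arith n y x w s E Z m p q r t = linear* 4 (11520 * w) (p ⊕ 8 * n ⊗ q ⊕ 12672 ⊗ r ⊕ 16 * n ⊗ t)
    (solve (n ∷ y ∷ x ∷ w ∷ s ∷ E ∷ Z ∷ m ∷ []))

  deficit-arith : ∀ κ l w s N → 27 * l + 27 * w + s ≤ 4 * N → κ * (4 * N) ≤ κ * (27 * l) + N →
          κ * (27 * w + s) ≤ N
  deficit-arith κ l w s N p q = linear 0 (κ ⊗ p ⊕ q) (solve (κ ∷ l ∷ w ∷ s ∷ N ∷ []))

module _ {n} (G : Graph n) (K : ℕ) (K-large : 55296 ≤ K) (K≤n : K ≤ n) where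

  private
    open module G = Counting G

    total-deficit : 24 * (K * K) * (4 * (n * (n * n * n))) ≤ 24 * (K * K) * (27 * Λᴴ G) + n * (n * n * n) →
      24 * (K * K) * (27 * G.weighted-ends + n * (∑[ x ] G.dev x * G.dev x)) ≤ n * (n * n * n)
    total-deficit = deficit-arith (24 * (K * K)) (Λᴴ G) G.weighted-ends (n * (∑[ x ] G.dev x * G.dev x)) (n * (n * n * n)) G.Λ-upper

  -- The gain carries no error term, so it remains meaningful for arbitrarily small deficits. The
  -- lower bound on the parts later lets every part contribute to `part-upper`.
  near-extremal : 24 * (K * K) * (4 * (n * (n * n * n))) ≤ 24 * (K * K) * (27 * Λᴴ G) + n * (n * n * n) →
    Σ[ p ∈ (Fin n → Fin 3) ] (∀ i → n ≤ 6 * part p i) ×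
      9216 * Λᴴ G + n * n * distance G (blowup K₃ p) ≤ 9216 * Λᴴ (blowup K₃ p)
  near-extremal dense = partition , large , gain
    where
    open Pivots G K K-large K≤n (total-deficit dense)
    open Partition G K K-large K≤n (total-deficit dense) triangle
    open Triangle triangle

    large : ∀ i → n ≤ 6 * part partition i
    large i = large-part n ρ (part partition i) (proj₂ (near-third i)) 9216[ρ+1]≤n

    small : ∀ i → 8 * part partition i ≤ 3 * n
    small i = small-part n ρ (part partition i) (proj₁ (near-third i)) 9216[ρ+1]≤n

    balanced : ∀ i → 9216 * (∣ 3 * part partition i - n ∣ + 1) ≤ n
    balanced i = ≤-trans (*-monoʳ-≤ 9216 (+-monoˡ-≤ 1
      (∣-∣-lub (3 * part partition i) n (proj₁ (near-third i)) (proj₂ (near-third i))))) 9216[ρ+1]≤n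

    total-ends≤total-cost : total-ends ≤ total-cost
    total-ends≤total-cost = ≤-trans (≤-reflexive (sym (+-assoc (ends a) (ends b) (ends c))))
      (m≤m+n (ends a) (centres a) ⊕ m≤m+n (ends b) (centres b) ⊕ m≤m+n (ends c) (centres c))

    n*distance≤ : n * distance G (blowup K₃ partition) ≤ 2 * (n * n * #unfair) + 1584 * M
    n*distance≤ = distance-arith n (distance G (blowup K₃ partition)) #unfair total-cost total-ends (# remote-fair) M
      distance≤ n*#remote-fair≤ total-ends≤total-cost n*cost≤

    gain : 9216 * Λᴴ G + n * n * distance G (blowup K₃ partition) ≤ 9216 * Λᴴ (blowup K₃ partition)
    gain = gain-arith n (Λᴴ G) (Λᴴ (blowup K₃ partition)) (Counting.weighted-ends G)
      (∑[ x ] Comparison.shift G partition x * Comparison.shift G partition x) (distance G (blowup K₃ partition)) #unfair M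
      (Comparison.comparison G partition 9216 balanced small) n*distance≤ nM≤2weighted-ends n²*#unfair≤

-- Densities as fractions

frac-≤ : ∀ a b c d .{{_ : NonZero b}} .{{_ : NonZero d}} → a * d ≤ c * b → + a / b ℚ.≤ + c / d
frac-≤ a (suc b) c (suc d) le =
  ℚ.*≤* (subst₂ ℤ._≤_ (ℤₚ.pos-* a (suc d)) (ℤₚ.pos-* c (suc b)) (ℤ.+≤+ le))

frac-< : ∀ a b c d .{{_ : NonZero b}} .{{_ : NonZero d}} → a * d < c * b → + a / b ℚ.< + c / d
frac-< a (suc b) c (suc d) lt =
  ℚ.*<* (subst₂ ℤ._<_ (ℤₚ.pos-* a (suc d)) (ℤₚ.pos-* c (suc b)) (ℤ.+<+ lt))

frac-≃ : ∀ a b c d .{{_ : NonZero b}} .{{_ : NonZero d}} → a * d ≡ c * b → + a / b ℚ.≃ + c / d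
frac-≃ a b c d eq = ℚₚ.≤-antisym (frac-≤ a b c d (≤-reflexive eq)) (frac-≤ c d a b (≤-reflexive (sym eq)))

frac-≤⁻¹ : ∀ a b c d .{{_ : NonZero b}} .{{_ : NonZero d}} → + a / b ℚ.≤ + c / d → a * d ≤ c * b
frac-≤⁻¹ a (suc b) c (suc d) (ℚ.*≤* le) =
  ℤₚ.drop‿+≤+ (subst₂ ℤ._≤_ (sym (ℤₚ.pos-* a (suc d))) (sym (ℤₚ.pos-* c (suc b))) le)

frac-+ : ∀ a b c d .{{_ : NonZero b}} .{{_ : NonZero d}} →
         + a / b ℚ.+ + c / d ℚ.≃ (+ (a * d + c * b) / (b * d)) {{m*n≢0 b d}}
frac-+ a (suc b) c (suc d) = ℚₚ.≃-reflexive (cong (_/ (suc b * suc d))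
  (trans (cong₂ ℤ._+_ (sym (ℤₚ.pos-* a (suc d))) (sym (ℤₚ.pos-* c (suc b)))) (sym (ℤₚ.pos-+ (a * suc d) (c * suc b)))))

frac-* : ∀ a b c d .{{_ : NonZero b}} .{{_ : NonZero d}} →
         (+ a / b) ℚ.* (+ c / d) ℚ.≃ (+ (a * c) / (b * d)) {{m*n≢0 b d}}
frac-* a (suc b) c (suc d) = ℚₚ.≃-reflexive (cong (_/ (suc b * suc d)) (sym (ℤₚ.pos-* a c)))

∣frac-frac∣ : ∀ a b c d .{{_ : NonZero b}} .{{_ : NonZero d}} →
              ℚ.∣ + a / b ℚ.- + c / d ∣ ℚ.≃ (+ ∣ a * d - c * b ∣ / (b * d)) {{m*n≢0 b d}}
∣frac-frac∣ a (suc b) c (suc d) = ℚₚ.≃-reflexive (cong (λ i → + i / (suc b * suc d))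
  (trans (cong ℤ.∣_∣ (cong₂ ℤ._+_ (sym (ℤₚ.pos-* a (suc d)))
    (trans (sym (ℤₚ.neg-distribˡ-* (+ c) (+ suc b))) (cong ℤ.-_ (sym (ℤₚ.pos-* c (suc b)))))))
  (abs-difference (a * suc d) (c * suc b))))
  where
  abs-difference : ∀ i j → ℤ.∣ + i ℤ.+ ℤ.- + j ∣ ≡ ∣ i - j ∣
  abs-difference i j with ≤-total i j
  ... | inj₁ i≤j = trans (cong ℤ.∣_∣ (ℤₚ.m-n≡m⊖n i j)) (trans (ℤₚ.∣⊖∣-≤ i≤j) (sym (m≤n⇒∣m-n∣≡n∸m i≤j)))
  ... | inj₂ j≤i = trans (cong ℤ.∣_∣ (ℤₚ.m-n≡m⊖n i j)) (trans (cong ℤ.∣_∣ (ℤₚ.⊖-≥ j≤i)) (sym (m≤n⇒∣n-m∣≡n∸m j≤i)))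

positive : ∀ ε → 0ℚᵘ ℚ.< ε → ∃[ m ] ∃[ d ] ε ≡ + suc m / suc d
positive (mkℚᵘ (+ suc m)      d) _ = m , d , refl
positive (mkℚᵘ (+ zero)       d) (ℚ.*<* (ℤ.+<+ ()))
positive (mkℚᵘ (ℤ.-[1+ _ ]) d) (ℚ.*<* ())

difference : ∀ p q → (p ℚ.+ q) ℚ.- p ℚ.≃ q
difference p q = begin
  (p ℚ.+ q) ℚ.- p        ≈⟨ ℚₚ.+-congˡ (ℚ.- p) (ℚₚ.+-comm p q) ⟩
  (q ℚ.+ p) ℚ.- p        ≈⟨ ℚₚ.+-assoc q p (ℚ.- p) ⟩
  q ℚ.+ (p ℚ.- p)        ≈⟨ ℚₚ.+-congʳ q (ℚₚ.+-inverseʳ p) ⟩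
  q ℚ.+ 0ℚᵘ              ≈⟨ ℚₚ.+-identityʳ q ⟩
  q                      ∎
  where open ℚₚ.≃-Reasoning

-- n P 4 = n⁴ - 6n³ + 11n² - 6n; substituting n = 4 + m makes all factors free of subtraction.
P-bounds : ∀ n → 4 ≤ n → 1 ≤ n P 4 × n P 4 ≤ n * (n * n * n) × n * (n * n * n) ≤ n P 4 + 6 * (n * n * n)
P-bounds n 4≤n with n | m≤n⇒∃[o]m+o≡n 4≤n
... | _ | m , refl = s≤s z≤n , ≤-trans (m≤m+n _ _) (≤-reflexive (upper m)) , ≤-trans (m≤m+n _ _) (≤-reflexive (lower m))
  where
  upper : ∀ m → (1 + m) * ((2 + m) * ((3 + m) * ((4 + m) * 1))) +
    (6 * m * (4 + m) * (4 + m) + 13 * (4 + m) * (4 + m) + 6 * (4 + m)) ≡ (4 + m) * ((4 + m) * (4 + m) * (4 + m))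
  upper = solve-∀
  lower : ∀ m → (4 + m) * ((4 + m) * (4 + m) * (4 + m)) + (11 * m + 38) * (4 + m) ≡
    (1 + m) * ((2 + m) * ((3 + m) * ((4 + m) * 1))) + 6 * ((4 + m) * (4 + m) * (4 + m))
  lower = solve-∀

nC2 : ∀ n → 2 * (n C 2) + n ≡ n * n
nC2 zero    = refl
nC2 (suc n) = trans (cong (λ c → 2 * c + suc n) (trans (sym (nCk+nC[k+1]≡[n+1]C[k+1] n 1)) (cong (_+ n C 2) (nC1≡n n))))
  (trans (regroup n (n C 2)) (trans (cong (λ s → s + (2 * n + 1)) (nC2 n)) (identity n)))
  where
  regroup : ∀ n c → 2 * (n + c) + suc n ≡ 2 * c + n + (2 * n + 1)
  regroup = solve-∀
  identity : ∀ n → n * n + (2 * n + 1) ≡ suc n * suc n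
  identity = solve-∀

ratio≡frac : ∀ a d .{{_ : NonZero d}} → ratio a d ≡ + a / d
ratio≡frac a (suc d) = refl

frac-+-same : ∀ a c b .{{_ : NonZero b}} → + (a + c) / b ℚ.≃ + a / b ℚ.+ + c / b
frac-+-same a c b = ℚₚ.≃-trans
  (frac-≃ (a + c) b (a * b + c * b) (b * b) {{it}} {{m*n≢0 b b}} (identity a c b))
  (ℚₚ.≃-sym (frac-+ a b c b))
  where
  identity : ∀ a c b → (a + c) * (b * b) ≡ (a * b + c * b) * b
  identity = solve-∀

module Densities {n} (4≤n : 4 ≤ n) where

  instance
    P≢0 : NonZero (n P 4)
    P≢0 = >-nonZero (proj₁ (P-bounds n 4≤n))

  P≤n⁴ : (n P 4) ≤ n * (n * n * n)
  P≤n⁴ = proj₁ (proj₂ (P-bounds n 4≤n))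

  n⁴≤P+6n³ : n * (n * n * n) ≤ (n P 4) + 6 * (n * n * n)
  n⁴≤P+6n³ = proj₂ (proj₂ (P-bounds n 4≤n))

  density≡frac : (G : Graph n) → density H G ≡ + Λᴴ G / (n P 4)
  density≡frac G = trans (cong (λ l → ratio l (n P 4)) (sym (Λᴴ≡Λ G))) (ratio≡frac (Λᴴ G) (n P 4))

  -- Replaces the maximal density by a graph that attains it, so that comparisons take place between
  -- numbers of embeddings.
  record Extremal : Set where
    field
      graph       : Graph n
      max≃density : maxDensity H n ℚ.≃ + Λᴴ graph / (n P 4)
      Λ≤          : (G : Graph n) → Λᴴ G ≤ Λᴴ graph

  extremal : Extremal
  extremal = fromAttained (maxDensity-attained H n)
    where
    fromAttained : Σ[ G ∈ Graph n ] density H G ℚ.≃ maxDensity H n → Extremal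
    fromAttained (G , attained) = record
      { graph = G
      ; max≃density = max≃
      ; Λ≤ = λ G′ → *-cancelʳ-≤ (Λᴴ G′) (Λᴴ G) (n P 4) (frac-≤⁻¹ (Λᴴ G′) (n P 4) (Λᴴ G) (n P 4)
          (ℚₚ.≤-respʳ-≃ max≃ (subst (ℚ._≤ maxDensity H n) (density≡frac G′) (density≤maxDensity H G′))))
      }
      where
      max≃ : maxDensity H n ℚ.≃ + Λᴴ G / (n P 4)
      max≃ = ℚₚ.≃-trans (ℚₚ.≃-sym attained) (ℚₚ.≃-reflexive (density≡frac G))

27Λ≤4n⁴ : (G : Graph n) → 27 * Λᴴ G ≤ 4 * (n * (n * n * n))
27Λ≤4n⁴ {n} G = ≤-trans (m≤m+n (27 * Λᴴ G) (27 * weighted-ends))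
  (≤-trans (m≤m+n _ (n * (∑[ x ] dev x * dev x))) Λ-upper)
  where open Counting G

-- The limit 4/27

semiInducibility : SemiInducibility H (+ 4 / 27)
semiInducibility ε 0<ε with positive ε 0<ε
-- From this order on, n P 4 is at least (6 + 4(d + 1))n³, and 27 · 4 exceeds the 43 in `near`.
... | m , d , refl = 12 + 4 * suc d , λ n N≤n → close n N≤n (≤-trans (m≤m+n 4 _) N≤n)
  where
  module _ (n : ℕ) (N≤n : 12 + 4 * suc d ≤ n) (4≤n : 4 ≤ n) where
    open Densities 4≤n
    open Extremal extremal

    near : ∣ Λᴴ graph * 27 - 4 * (n P 4) ∣ ≤ 43 * (n * n * n)
    near = ∣-∣-lub (Λᴴ graph * 27) (4 * (n P 4))
      (above (Λᴴ graph) (n P 4) (n * (n * n * n)) (n * n * n) (27Λ≤4n⁴ graph) n⁴≤P+6n³)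
      (below (Λᴴ graph) (Λᴴ (blowup K₃ (turán n))) (n P 4) (n * (n * n * n)) (n * n * n) (Λ-turán n) (Λ≤ (blowup K₃ (turán n))) P≤n⁴)
      where
      above : ∀ l P q c → 27 * l ≤ 4 * q → q ≤ P + 6 * c → l * 27 ≤ 4 * P + 43 * c
      above l P q c h h′ = linear (19 * c) (h ⊕ 4 ⊗ h′) (solve (l ∷ P ∷ q ∷ c ∷ []))
      below : ∀ l t P q c → 4 * q ≤ 27 * t + 43 * c → t ≤ l → P ≤ q → 4 * P ≤ l * 27 + 43 * c
      below l t P q c h h′ h″ = linear 0 (h ⊕ 27 ⊗ h′ ⊕ 4 ⊗ h″) (solve (l ∷ t ∷ P ∷ q ∷ c ∷ []))

    small : 43 * (n * n * n) * suc d < suc m * ((n P 4) * 27)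
    small = ≤-trans (arith n (n * n * n) (n P 4) (suc d) N≤n n⁴≤P+6n³ (*-mono-≤ (*-mono-≤ 1≤n 1≤n) 1≤n))
                    (m≤m+n _ _)
      where
      1≤n : 1 ≤ n
      1≤n = ≤-trans (m≤m+n 1 3) 4≤n
      arith : ∀ n c P q → 12 + 4 * q ≤ n → n * c ≤ P + 6 * c → 1 ≤ c → 1 + 43 * c * q ≤ P * 27
      arith n c P q h h′ h″ = linear (65 * c * q + 161 * c) (27 * c ⊗ h ⊕ 27 ⊗ h′ ⊕ h″) (solve (n ∷ c ∷ P ∷ q ∷ []))

    close : ℚ.∣ maxDensity H n ℚ.- + 4 / 27 ∣ ℚ.< + suc m / suc d
    close = ℚₚ.<-respˡ-≃ (ℚₚ.≃-sym (ℚₚ.≃-trans (ℚₚ.∣-∣-cong (ℚₚ.+-congˡ (ℚ.- (+ 4 / 27)) max≃density))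
        (∣frac-frac∣ (Λᴴ graph) (n P 4) 4 27)))
      (frac-< _ ((n P 4) * 27) (suc m) (suc d) {{m*n≢0 (n P 4) 27}}
        (≤-<-trans (*-monoˡ-≤ (suc d) near) small))

m*m≤n*n⇒m≤n : ∀ {m n} → m * m ≤ n * n → m ≤ n
m*m≤n*n⇒m≤n {m} {n} le with m ≤? n
... | yes m≤n = m≤n
... | no  m≰n = contradiction le (<⇒≱ (*-mono-< (≰⇒> m≰n) (≰⇒> m≰n)))

-- In the following estimates c = n³ and q = n⁴, while l and l′ stand for the
-- numbers of embeddings of H into G and into a blowup of K₃.

private
  tolerance-arith : ∀ n c l u P → 4 * (P * (28 * u)) ≤ (l * (28 * u) + 1 * P) * 27 →
    n * c ≤ P + 6 * c → P ≤ n * c → 24 * (28 * u) ≤ n → u * (4 * (n * c)) ≤ u * (27 * l) + n * c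
  tolerance-arith n c l u P h h₁ h₂ h₃ = linear* 28 0
    (4 * (28 * u) ⊗ h₁ ⊕ h ⊕ 27 ⊗ h₂ ⊕ c ⊗ h₃) (solve (n ∷ c ∷ l ∷ u ∷ P ∷ []))

  weaken-arith : ∀ κ j q l → 1 ≤ j → κ * j * (4 * q) ≤ κ * j * (27 * l) + q → κ * (4 * q) ≤ κ * (27 * l) + q
  weaken-arith κ (suc i) q l _ h = linear* (suc i) (i * q) h (solve (κ ∷ i ∷ q ∷ l ∷ []))

  edit-arith : ∀ κ u q l l′ e → 9216 ≤ κ → 9216 * l + e ≤ 9216 * l′ → 27 * l′ ≤ 4 * q →
    u * (4 * q) ≤ u * (27 * l) + q → u * e ≤ κ * q
  edit-arith κ u q l l′ e h h₁ h₂ h₃ = linear (26 * u * e)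
    (q ⊗ h ⊕ 27 * u ⊗ h₁ ⊕ 9216 * u ⊗ h₂ ⊕ 9216 ⊗ h₃) (solve (κ ∷ u ∷ q ∷ l ∷ l′ ∷ e ∷ []))

  part-arith : ∀ u q l l′ s → l ≤ l′ → 27 * l′ + s ≤ 4 * q → u * (4 * q) ≤ u * (27 * l) + q → u * s ≤ q
  part-arith u q l l′ s h h₁ h₂ = linear 0 (27 * u ⊗ h ⊕ u ⊗ h₁ ⊕ h₂) (solve (u ∷ q ∷ l ∷ l′ ∷ s ∷ []))

  part-arith′ : ∀ n κ u q r s → 6 ≤ κ → n ≤ 6 * s → u * (n * (s * r)) ≤ q → u * (n * n * r) ≤ κ * q
  part-arith′ n κ u q r s h h₁ h₂ = linear 0 (q ⊗ h ⊕ u * n * r ⊗ h₁ ⊕ 6 ⊗ h₂) (solve (n ∷ κ ∷ u ∷ q ∷ r ∷ s ∷ []))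

  cancel-arith : ∀ n κ j x .{{_ : NonZero n}} .{{_ : NonZero κ}} → κ * j * (n * n * x) ≤ κ * (n * (n * n * n)) → j * x ≤ n * n
  cancel-arith n κ j x h = *-cancelˡ-≤ (n * n) {{m*n≢0 n n}} (*-cancelˡ-≤ κ
    (≤-trans (≤-reflexive (left n κ j x)) (≤-trans h (≤-reflexive (right n κ)))))
    where
    left : ∀ n κ j x → κ * (n * n * (j * x)) ≡ κ * j * (n * n * x)
    left = solve-∀
    right : ∀ n κ → κ * (n * (n * n * n)) ≡ κ * (n * n * (n * n))
    right = solve-∀

  binomial-arith : ∀ n b q E → 2 * b + n ≡ n * n → 4 ≤ n → 4 * suc q * suc q * E ≤ n * n → E * suc q ≤ b
  binomial-arith n b q E h h₁ h₂ = linear* 4 (4 * (q * suc q * E) + 2 * n)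
    (h₂ ⊕ n ⊗ h₁ ⊕ 2 ⊗ ≤-reflexive (sym h)) (identity n b q E)
    where
    identity : ∀ n b q E → 4 * b + (4 * suc q * suc q * E + n * 4 + 2 * (n * n)) ≡
               4 * (E * suc q) + (n * n + n * n + 2 * (2 * b + n)) + (4 * (q * suc q * E) + 2 * n)
    identity = solve-∀

  -- 86 = 2 · 43: the error 43n³ of the Turán graph is at most half of n⁴ / κ. The other half of the
  -- deficit remains as the advantage of l′ over l.
  sparse-arith : ∀ n c κ l l′ → κ * (27 * l) + n * c ≤ κ * (4 * (n * c)) →
    4 * (n * c) ≤ 27 * l′ + 43 * c → 86 * κ ≤ n → l ≤ l′ → n * c + 86 * κ * l ≤ 86 * κ * l′
  sparse-arith n c κ l l′ h h₁ h₂ h₃ = linear 0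
    (2 ⊗ h ⊕ 2 * κ ⊗ h₁ ⊕ c ⊗ h₂ ⊕ 32 * κ ⊗ h₃) (solve (n ∷ c ∷ κ ∷ l ∷ l′ ∷ []))

  enlarge-arith : ∀ a C e l l′ → a ≤ C → a * l + e ≤ a * l′ → l ≤ l′ → e + C * l ≤ C * l′
  enlarge-arith a C e l l′ h h₁ h₂ with m≤n⇒∃[o]m+o≡n h
  ... | b , refl = linear 0 (h₁ ⊕ b ⊗ h₂) (solve (a ∷ b ∷ e ∷ l ∷ l′ ∷ []))

  square-arith : ∀ r d → r * suc d * (r * suc d) + 3 * (r * suc d * (r * suc d)) ≡ 4 * suc d * suc d * (r * r)
  square-arith = solve-∀

  wide-arith : ∀ n d m r → r * suc d ≤ n → 1 ≤ n → r * (suc d * 1) < suc m * n * (1 * (3 * 1))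
  wide-arith n d m r h h₁ = linear (n + 3 * m * n) (h ⊕ h₁) (solve (r ∷ d ∷ m ∷ n ∷ []))

  few-arith : ∀ d m s E b → s ≤ E → E * suc d ≤ b → s * (suc d * 1) ≤ suc m * b * 1
  few-arith d m s E b h h₁ = linear (m * b) (suc d ⊗ h ⊕ h₁) (solve (s ∷ E ∷ b ∷ d ∷ m ∷ []))

  quartic-arith : ∀ n → n * n * (n * n) ≡ n * (n * n * n)
  quartic-arith = solve-∀

  -- The density gap is Δ / P with P ≤ n⁴; multiplied by Cn² it is at least CΔ / n², which is at
  -- least the distance.
  gap-arith : ∀ n e E P C Δ → e ≤ E → P ≤ n * (n * n * n) → n * n * E ≤ C * Δ →
    e * (1 * P * 1) ≤ C * Δ * (n * (n * 1)) * 1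
  gap-arith n e E P C Δ h h₁ h₂ = linear 0 (P ⊗ h ⊕ E ⊗ h₁ ⊕ n * n ⊗ h₂) (solve (n ∷ e ∷ E ∷ P ∷ C ∷ Δ ∷ []))

-- The two stability statements

module Stability (K : ℕ) (K-large : 55296 ≤ K) where

  κ : ℕ
  κ = 24 * (K * K)

  K≤κ : K ≤ κ
  K≤κ = arith K (≤-trans (≤ᵇ⇒≤ 1 55296 _) K-large)
    where
    arith : ∀ K → 1 ≤ K → K ≤ 24 * (K * K)
    arith K h = linear (23 * (K * K)) (K ⊗ h) (solve (K ∷ []))

  ≤κ : ∀ k → T (k ≤ᵇ 55296) → k ≤ κ
  ≤κ k k≤ = ≤-trans (≤-trans (≤ᵇ⇒≤ k 55296 k≤) K-large) K≤κ

  instance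
    κ≢0 : NonZero κ
    κ≢0 = >-nonZero (≤κ 1 _)

  module Tolerance {n} (4≤n : 4 ≤ n) (K≤n : K ≤ n) (G : Graph n) (d : ℕ) where

    j : ℕ
    -- The deficit controls the squares of the deviations of the part sizes, so accuracy 1 / (d + 1)
    -- requires the square of d + 1.
    j = 4 * suc d * suc d

    record Approximation : Set where
      field
        p     : Fin n → Fin 3
        parts : ∀ i → ∣ 3 * part p i - n ∣ * suc d ≤ n
        edits : distance G (blowup K₃ p) * suc d ≤ n C 2

    private
      instance
        n≢0 : NonZero n
        n≢0 = >-nonZero (≤-trans (m≤m+n 1 3) 4≤n)

    -- The blowup has at least as many embeddings as G, so `part-upper` applied to the blowup itself
    -- balances the parts. Its advantage over G is at most the deficit of G and bounds the wrong
    -- pairs.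
    approximation : κ * j * (4 * (n * (n * n * n))) ≤ κ * j * (27 * Λᴴ G) + n * (n * n * n) → Approximation
    approximation dense = build
      (near-extremal G K K-large K≤n (weaken-arith κ j (n * (n * n * n)) (Λᴴ G) (s≤s z≤n) dense))
      where
      build : Σ[ p ∈ (Fin n → Fin 3) ] (∀ i → n ≤ 6 * part p i) ×
        9216 * Λᴴ G + n * n * distance G (blowup K₃ p) ≤ 9216 * Λᴴ (blowup K₃ p) → Approximation
      build (p , large , gain) = record
        { p = p
        ; parts = λ i → m*m≤n*n⇒m≤n (square (∣ 3 * part p i - n ∣) (cancel-arith n κ j _
            (part-arith′ n κ (κ * j) (n * (n * n * n)) _ (part p i) (≤κ 6 _) (large i)
              (part-arith (κ * j) (n * (n * n * n)) (Λᴴ G) (Λᴴ (blowup K₃ p)) _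
                (*-cancelˡ-≤ 9216 (≤-trans (m≤m+n _ _) gain)) (part-upper p i) dense))))
        ; edits = binomial-arith n (n C 2) d (distance G (blowup K₃ p)) (nC2 n) 4≤n (cancel-arith n κ j _
            (edit-arith κ (κ * j) (n * (n * n * n)) (Λᴴ G) (Λᴴ (blowup K₃ p)) _ (≤κ 9216 _) gain
              (27Λ≤4n⁴ (blowup K₃ p)) dense))
        }
        where
        square : ∀ r → j * (r * r) ≤ n * n → r * suc d * (r * suc d) ≤ n * n
        square r le = ≤-trans (m≤m+n _ _) (≤-trans (≤-reflexive (square-arith r d)) le)

  Approximable : ℚᵘ → Set
  Approximable ε = ∃[ δ ] ∃[ n₀ ] 0ℚᵘ ℚ.< δ × 4 ≤ n₀ ×
    (∀ n (G : Graph n) → n₀ ≤ n → + 4 / 27 ℚ.- δ ℚ.≤ density H G →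
      Σ[ p ∈ (Fin n → Fin 3) ]
        (∀ i → ℚ.∣ fromℕ (partSize p i) ℚ.- weight thirds i ℚ.* fromℕ n ∣ ℚ.< ε ℚ.* fromℕ n) ×
        fromℕ (symDiff G (blowup K₃ p)) ℚ.≤ ε ℚ.* fromℕ (n C 2))

  approximable : ∀ m d → Approximable (+ suc m / suc d)
  approximable m d = + 1 / k , 4 + (K + 24 * k) , frac-< 0 1 1 k (s≤s z≤n) , m≤m+n 4 _ ,
        λ n G n₀≤n → stable n G n₀≤n (≤-trans (m≤m+n 4 _) n₀≤n)
    where
    u k : ℕ
    u = κ * (4 * suc d * suc d)
    -- Of the permitted deficit n⁴ / u, δ = 1 / k takes up at most 27/28. The rest covers the
    -- passage from 4 · n P 4 to 4n⁴, which costs at most 24n³ ≤ n⁴ / k.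
    k = 28 * u

    instance
      u≢0 : NonZero u
      u≢0 = m*n≢0 κ (4 * suc d * suc d)

      k≢0 : NonZero k
      k≢0 = m*n≢0 28 u

    module _ (n : ℕ) (G : Graph n) (n₀≤n : 4 + (K + 24 * k) ≤ n) (4≤n : 4 ≤ n)
             (dense : + 4 / 27 ℚ.- + 1 / k ℚ.≤ density H G) where
      open Densities 4≤n

      K≤n : K ≤ n
      K≤n = ≤-trans (m≤m+n K (24 * k)) (≤-trans (m≤n+m (K + 24 * k) 4) n₀≤n)

      24k≤n : 24 * k ≤ n
      24k≤n = ≤-trans (m≤n+m (24 * k) K) (≤-trans (m≤n+m (K + 24 * k) 4) n₀≤n)

      4/27≤ : + 4 / 27 ℚ.≤ + Λᴴ G / (n P 4) ℚ.+ + 1 / k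
      4/27≤ = ℚₚ.≤-respˡ-≃ cancel (subst (λ D → + 4 / 27 ℚ.- + 1 / k ℚ.+ + 1 / k ℚ.≤ D ℚ.+ + 1 / k)
                (density≡frac G) (ℚₚ.+-monoˡ-≤ (+ 1 / k) dense))
        where
        cancel : + 4 / 27 ℚ.- + 1 / k ℚ.+ + 1 / k ℚ.≃ + 4 / 27
        cancel = ℚₚ.≃-trans (ℚₚ.+-assoc (+ 4 / 27) (ℚ.- (+ 1 / k)) (+ 1 / k))
          (ℚₚ.≃-trans (ℚₚ.+-congʳ (+ 4 / 27) (ℚₚ.+-inverseˡ (+ 1 / k))) (ℚₚ.+-identityʳ (+ 4 / 27)))

      open Tolerance 4≤n K≤n G d

      approx : Approximation
      approx = approximation (tolerance-arith n (n * n * n) (Λᴴ G) u (n P 4)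
        (frac-≤⁻¹ 4 27 (Λᴴ G * k + 1 * (n P 4)) ((n P 4) * k) {{_}} {{m*n≢0 (n P 4) k}}
          (ℚₚ.≤-respʳ-≃ (frac-+ (Λᴴ G) (n P 4) 1 k) 4/27≤))
        n⁴≤P+6n³ P≤n⁴ 24k≤n)

      open Approximation approx

      stable : Σ[ p ∈ (Fin n → Fin 3) ]
        (∀ i → ℚ.∣ fromℕ (partSize p i) ℚ.- + 1 / 3 ℚ.* fromℕ n ∣ ℚ.< + suc m / suc d ℚ.* fromℕ n) ×
        fromℕ (symDiff G (blowup K₃ p)) ℚ.≤ + suc m / suc d ℚ.* fromℕ (n C 2)
      stable = p , balanced , close
        where
        balanced : ∀ i → ℚ.∣ fromℕ (partSize p i) ℚ.- + 1 / 3 ℚ.* fromℕ n ∣ ℚ.< + suc m / suc d ℚ.* fromℕ n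
        balanced i = subst (λ s → ℚ.∣ fromℕ s ℚ.- + 1 / 3 ℚ.* fromℕ n ∣ ℚ.< + suc m / suc d ℚ.* fromℕ n)
          (sym (partSize≡part p i)) (ℚₚ.<-respˡ-≃ (ℚₚ.≃-sym (ℚₚ.≃-trans
            (ℚₚ.∣-∣-cong (ℚₚ.+-congʳ (fromℕ (part p i)) (ℚₚ.-‿cong (frac-* 1 3 n 1))))
            (∣frac-frac∣ (part p i) 1 (1 * n) (3 * 1))))
          (ℚₚ.<-respʳ-≃ (ℚₚ.≃-sym (frac-* (suc m) (suc d) n 1))
          (frac-< _ (1 * (3 * 1)) (suc m * n) (suc d * 1)
            (≤-<-trans (≤-reflexive (cong₂ (λ s t → ∣ s - t ∣ * (suc d * 1)) (*-comm (part p i) 3)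
              (trans (*-identityʳ (1 * n)) (*-identityˡ n))))
            (wide-arith n d m ∣ 3 * part p i - n ∣ (parts i) (≤-trans (m≤m+n 1 3) 4≤n))))))

        close : fromℕ (symDiff G (blowup K₃ p)) ℚ.≤ + suc m / suc d ℚ.* fromℕ (n C 2)
        close = ℚₚ.≤-respʳ-≃ (ℚₚ.≃-sym (frac-* (suc m) (suc d) (n C 2) 1))
          (frac-≤ (symDiff G (blowup K₃ p)) 1 (suc m * (n C 2)) (suc d * 1)
            (few-arith d m (symDiff G (blowup K₃ p)) (distance G (blowup K₃ p)) (n C 2)
              (symDiff≤distance G (blowup K₃ p)) edits))

  approximable-positive : ∀ ε → ∃[ m ] ∃[ d ] ε ≡ + suc m / suc d → Approximable ε
  approximable-positive _ (m , d , refl) = approximable m d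

  erdősSimonovitsStable : ErdősSimonovitsStable H K₃ thirds
  erdősSimonovitsStable = + 4 / 27 , semiInducibility , λ ε 0<ε → approximable-positive ε (positive ε 0<ε)

  C₀ : ℕ
  C₀ = 86 * κ

  κ≤C₀ : κ ≤ C₀
  κ≤C₀ = m≤m+n κ (85 * κ)

  perfectlyStable : PerfectlyStable H K₃
  perfectlyStable = fromℕ C₀ , frac-< 0 1 C₀ 1 (≤-trans (≤-trans (≤κ 1 _) κ≤C₀) (≤-reflexive (sym (*-identityʳ C₀)))) ,
    frac-≤ 4 1 C₀ 1 (≤-trans (≤-trans (≤κ 4 _) κ≤C₀) (≤-reflexive (sym (*-identityʳ C₀)))) ,
    λ n G C₀≤n → stable n G (subst₂ _≤_ (*-identityʳ C₀) (*-identityʳ n) (frac-≤⁻¹ C₀ 1 n 1 C₀≤n))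
    where
    module _ (n : ℕ) (G : Graph n) (C₀≤n : C₀ ≤ n) where
      4≤n : 4 ≤ n
      4≤n = ≤-trans (≤-trans (≤κ 4 _) κ≤C₀) C₀≤n

      open Densities 4≤n
      open Extremal extremal

      choice : Σ[ p ∈ (Fin n → Fin 3) ] n * n * distance G (blowup K₃ p) + C₀ * Λᴴ G ≤ C₀ * Λᴴ graph
      choice = dichotomy (≤-total (κ * (4 * (n * (n * n * n)))) (κ * (27 * Λᴴ G) + n * (n * n * n)))
        where
        dichotomy : κ * (4 * (n * (n * n * n))) ≤ κ * (27 * Λᴴ G) + n * (n * n * n) ⊎
                    κ * (27 * Λᴴ G) + n * (n * n * n) ≤ κ * (4 * (n * (n * n * n))) →
                    Σ[ p ∈ (Fin n → Fin 3) ] n * n * distance G (blowup K₃ p) + C₀ * Λᴴ G ≤ C₀ * Λᴴ graph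
        dichotomy (inj₁ dense) = extract (near-extremal G K K-large (≤-trans K≤κ (≤-trans κ≤C₀ C₀≤n)) dense)
          where
          extract : Σ[ p ∈ (Fin n → Fin 3) ] (∀ i → n ≤ 6 * part p i) ×
            9216 * Λᴴ G + n * n * distance G (blowup K₃ p) ≤ 9216 * Λᴴ (blowup K₃ p) →
            Σ[ p ∈ (Fin n → Fin 3) ] n * n * distance G (blowup K₃ p) + C₀ * Λᴴ G ≤ C₀ * Λᴴ graph
          extract (p , _ , gain) = p , enlarge-arith 9216 C₀ (n * n * distance G (blowup K₃ p)) (Λᴴ G) (Λᴴ graph)
            (≤-trans (≤κ 9216 _) κ≤C₀) (≤-trans gain (*-monoʳ-≤ 9216 (Λ≤ (blowup K₃ p)))) (Λ≤ G)
        -- A deficit of at least n⁴ / κ pays for the distance to any blowup, as this is at most n².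
        dichotomy (inj₂ sparse) = turán n , ≤-trans
          (+-monoˡ-≤ (C₀ * Λᴴ G) (≤-trans (*-monoʳ-≤ (n * n) (distance≤n² G (blowup K₃ (turán n)))) (≤-reflexive (quartic-arith n))))
          (sparse-arith n (n * n * n) κ (Λᴴ G) (Λᴴ graph) sparse
            (≤-trans (Λ-turán n) (+-monoˡ-≤ (43 * (n * n * n)) (*-monoʳ-≤ 27 (Λ≤ (blowup K₃ (turán n)))))) C₀≤n (Λ≤ G))

      Δ : ℕ
      Δ = Λᴴ graph ∸ Λᴴ G

      gap : maxDensity H n ℚ.- density H G ℚ.≃ + Δ / (n P 4)
      gap = ℚₚ.≃-trans
        (ℚₚ.+-cong (ℚₚ.≃-trans max≃density (ℚₚ.≃-trans (ℚₚ.≃-reflexive (cong (λ l → + l / (n P 4)) (sym (m+[n∸m]≡n (Λ≤ G)))))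
                     (frac-+-same (Λᴴ G) Δ (n P 4))))
                   (ℚₚ.-‿cong (ℚₚ.≃-reflexive (density≡frac G))))
        (difference (+ Λᴴ G / (n P 4)) (+ Δ / (n P 4)))

      stable : Σ[ p ∈ (Fin n → Fin 3) ] fromℕ (editDistance G (blowup K₃ p)) ℚ.≤
               fromℕ C₀ ℚ.* (maxDensity H n ℚ.- density H G) ℚ.* fromℕ (n ^ 2)
      stable = proj₁ choice , ℚₚ.≤-respʳ-≃ (ℚₚ.≃-sym expand)
        (frac-≤ e 1 (C₀ * Δ * (n ^ 2)) (1 * (n P 4) * 1) {{_}} {{m*n≢0 (1 * (n P 4)) 1 {{m*n≢0 1 (n P 4)}}}}
          (gap-arith n e (distance G G′) (n P 4) C₀ Δ (editDistance≤distance G G′) P≤n⁴ weighted))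
        where
        G′ = blowup K₃ (proj₁ choice)
        e = editDistance G G′

        expand : fromℕ C₀ ℚ.* (maxDensity H n ℚ.- density H G) ℚ.* fromℕ (n ^ 2) ℚ.≃
                 (+ (C₀ * Δ * (n ^ 2)) / (1 * (n P 4) * 1)) {{m*n≢0 (1 * (n P 4)) 1 {{m*n≢0 1 (n P 4)}}}}
        expand = ℚₚ.≃-trans
          (ℚₚ.*-congʳ (ℚₚ.≃-trans (ℚₚ.*-congˡ {fromℕ C₀} gap) (frac-* C₀ 1 Δ (n P 4))))
          (frac-* (C₀ * Δ) (1 * (n P 4)) (n ^ 2) 1 {{m*n≢0 1 (n P 4)}})

        weighted : n * n * distance G G′ ≤ C₀ * Δ
        weighted = subst (n * n * distance G G′ ≤_) (sym (*-distribˡ-∸ C₀ (Λᴴ graph) (Λᴴ G)))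
          (m+n≤o⇒m≤o∸n (n * n * distance G G′) (proj₂ choice))


theorem3p5 : SemiInducibility H (+ 4 / 27) × ErdősSimonovitsStable H K₃ thirds × PerfectlyStable H K₃
theorem3p5 = semiInducibility , erdősSimonovitsStable , perfectlyStable
  where open Stability 55296 ≤-refl
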